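{- Let $G$ be a plane elementary bipartite graph whose infinite face is forcing, with a reducible face decomposition $\mathrm{RFD}(G_1,\dots,G_n)$ associated with finite faces $s_1,\dots,s_n$ ($n\ge1$), $s_i$ a reducible face of $G_i$ for $2\le i\le n$. Run the following algorithm: set $\mathbf{L_1}=\{0,1\}$; for $i=1,\dots,n-1$, let $P_{i+1}$ be the common periphery of $s_{i+1}$ and $G_{i+1}$; if, along the clockwise orientation of the periphery of $G_{i+1}$, the two end vertices of $P_{i+1}$ are colored white and black respectively, set $$\mathbf{L_{i+1}}=\{x0: x\in\mathbf{L_i}\}\cup\{x1: x\in\mathbf{L_i},\ (x)_j=1 \text{ for all } j \text{ such that } s_j \text{ is a finite face of } G_i \text{ having common edges with } s_{i+1}\};$$ otherwise set $$\mathbf{L_{i+1}}=\{x1: x\in\mathbf{L_i}\}\cup\{x0: x\in\mathbf{L_i},\ (x)_j=0 \text{ for all } j \text{ such that } s_j \text{ is a finite face of } G_i \text{ having common edges with } s_{i+1}\},$$ where $(x)_j$ is the $j$-th digit of $x$. Then the output $\mathbf{L_n}$ is a binary coding of length $n$ of $\mathcal{M}(G)$ in which the binary string of each $M\in\mathcal{M}(G)$ is $\phi_M=\phi_M(s_1)\phi_M(s_2)\cdots\phi_M(s_n)$; that is, $\mathbf{L_n}=\{\phi_M: M\in\mathcal{M}(G)\}$ with $M\mapsto\phi_M$ a bijection from $\mathcal{M}(G)$ onto $\mathbf{L_n}$.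
   Context: All graphs are finite; $\mathcal{M}(G)$ is the set of perfect matchings of $G$. A bipartite graph is elementary if connected and every edge lies in some perfect matching. The vertices of $G$ are properly colored black and white (the same coloring is used throughout). Reducible face decomposition: $G_1=e+P_1$ is an even cycle bounding finite face $s_1$ (edge $e$ plus odd path $P_1$ with the same ends); $G_i=G_{i-1}+P_i$ adds an odd path $P_i$ in the exterior of $G_{i-1}$ meeting $G_{i-1}$ exactly in its two end vertices, with $P_i$ and part of the periphery of $G_{i-1}$ bounding a finite face $s_i$; $G_n=G$. The infinite face of $G$ is forcing if the periphery of $G$ is an even cycle and deleting all periphery vertices leaves either the empty graph or a graph with exactly one perfect matching. For $M\in\mathcal{M}(G)$, an $M$-alternating cycle $C$ is proper if every edge of $C$ in $M$ goes from white to black along the clockwise orientation of $C$; $M_{\hat0}$ is the unique perfect matching of $G$ with no proper $M_{\hat0}$-alternating cycle; $\phi_M(f)$ is the number of cycles of the symmetric difference $M\oplus M_{\hat0}$ containing the finite face $f$ in their interior. -}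

module Defs where

open import Data.Nat using (ℕ; zero; suc; _+_; _*_; _<_; _≤_)
open import Data.Fin using (Fin; toℕ; fromℕ<)
open import Data.Bool using (Bool; true; false)
open import Data.Vec using (Vec; []; _∷_; _∷ʳ_; lookup)
open import Data.List using (List; length)
open import Data.List.Relation.Unary.All using (All)
open import Data.List.Relation.Unary.Unique.Propositional using (Unique)
open import Data.List.Membership.Propositional using () renaming (_∈_ to _∈ᴸ_)
open import Data.Fin.Subset using (Subset; _∈_; _∉_)
open import Data.Product using (Σ; Σ-syntax; ∃; ∃-syntax; _×_; _,_)
open import Data.Sum using (_⊎_)
open import Relation.Nullary using (¬_)
open import Relation.Binary.PropositionalEquality using (_≡_; _≢_)
open import Relation.Binary.Construct.Closure.ReflexiveTransitive using (Star)

iter : {A : Set} → (A → A) → ℕ → A → A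
iter f zero    a = a
iter f (suc k) a = f (iter f k a)

CountIs : {A : Set} → (A → Set) → ℕ → Set
CountIs {A} P k =
  Σ[ xs ∈ List A ] (Unique xs × All P xs × (∀ a → P a → a ∈ᴸ xs) × length xs ≡ k)

data Color : Set where
  white black : Color

-- A properly 2-coloured graph embedded via a combinatorial map.
-- Darts: Fin nD.  tail d : the vertex the dart d leaves.  α : reversal of a dart
-- (edge = {d , α d}).  σ d : the next dart clockwise around tail d.
-- dInf : a dart whose left face is the infinite face.
record PlaneBipartiteGraph : Set where
  field
    nV nD     : ℕ
    tail      : Fin nD → Fin nV
    α σ       : Fin nD → Fin nD
    α-invol   : ∀ d → α (α d) ≡ d
    α-fixfree : ∀ d → α d ≢ d
    σ-inj     : ∀ d d' → σ d ≡ σ d' → d ≡ d'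
    σ-tail    : ∀ d → tail (σ d) ≡ tail d
    σ-trans   : ∀ d d' → tail d ≡ tail d' → ∃[ k ] iter σ k d ≡ d'
    dInf      : Fin nD
    color     : Fin nV → Color
    proper    : ∀ d → color (tail d) ≢ color (tail (α d))
    -- simple graph: no parallel edges (loops excluded by the proper colouring)
    simple    : ∀ d d' → tail d ≡ tail d' → tail (α d) ≡ tail (α d') → d ≡ d'

module _ (G : PlaneBipartiteGraph) where
  open PlaneBipartiteGraph G

  head : Fin nD → Fin nV
  head d = tail (α d)

  -- face traversal: the face on the left of d continues with φ d
  φ : Fin nD → Fin nD
  φ d = σ (α d)

  SameFace : Fin nD → Fin nD → Set
  SameFace d d' = ∃[ k ] iter φ k d ≡ d'

  IsFace : Subset nD → Set
  IsFace S = ∃[ d ] (∀ d' → (d' ∈ S → SameFace d d') × (SameFace d d' → d' ∈ S))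

  data ConnStep : Fin nD → Fin nD → Set where
    rev : ∀ d → ConnStep d (α d)
    rot : ∀ d → ConnStep d (σ d)

  Connected : Set
  Connected = (∀ v → ∃[ d ] tail d ≡ v) × (∀ d d' → Star ConnStep d d')

  -- genus 0 (Euler's formula V - E + F = 2 with E = nD / 2), for a connected map
  IsPlane : Set
  IsPlane = Connected × (∃[ F ] (CountIs IsFace F × 2 * (nV + F) ≡ 4 + nD))

  PerfectMatching : Subset nD → Set
  PerfectMatching M =
    (∀ d → d ∈ M → α d ∈ M) ×
    (∀ v → ∃[ d ] (tail d ≡ v × d ∈ M × (∀ d' → tail d' ≡ v → d' ∈ M → d' ≡ d)))

  Elementary : Set
  Elementary = Connected × (∀ d → ∃[ M ] (PerfectMatching M × d ∈ M))

  FacialCycle : Fin nD → Set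
  FacialCycle f = ∀ d d' → SameFace f d → SameFace f d' → tail d ≡ tail d' → d ≡ d'

  OnPeriphery : Fin nV → Set
  OnPeriphery v = ∃[ d ] (SameFace dInf d × tail d ≡ v)

  InnerPerfectMatching : Subset nD → Set
  InnerPerfectMatching M =
    (∀ d → d ∈ M → α d ∈ M) ×
    (∀ d → d ∈ M → ¬ OnPeriphery (tail d)) ×
    (∀ v → ¬ OnPeriphery v →
       ∃[ d ] (tail d ≡ v × d ∈ M × (∀ d' → tail d' ≡ v → d' ∈ M → d' ≡ d)))

  -- forcing infinite face (the empty graph has exactly one perfect matching,
  -- so both cases of the definition are covered by "exactly one")
  ForcingInfiniteFace : Set
  ForcingInfiniteFace =
    FacialCycle dInf ×
    (∃[ M ] (InnerPerfectMatching M × (∀ M' → InnerPerfectMatching M' → M' ≡ M)))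

  -- cycles, as α-closed edge sets that are connected and 2-regular on their vertices
  data CycStep (C : Subset nD) : Fin nD → Fin nD → Set where
    along : ∀ d → d ∈ C → CycStep C d (α d)
    pivot : ∀ d d' → d ∈ C → d' ∈ C → tail d ≡ tail d' → CycStep C d d'

  IsCycle : Subset nD → Set
  IsCycle C =
    (∀ d → d ∈ C → α d ∈ C) ×
    (∃[ d ] d ∈ C) ×
    (∀ d → d ∈ C → ∃[ d' ] (d' ∈ C × d' ≢ d × tail d' ≡ tail d ×
        (∀ d'' → d'' ∈ C → tail d'' ≡ tail d → d'' ≡ d ⊎ d'' ≡ d'))) ×
    (∀ d d' → d ∈ C → d' ∈ C → Star (CycStep C) d d')

  -- faces (represented by darts on them) reachable from each other
  -- without crossing an edge of C
  data SideStep (C : Subset nD) : Fin nD → Fin nD → Set where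
    face  : ∀ d → SideStep C d (φ d)
    face⁻ : ∀ d → SideStep C (φ d) d
    cross : ∀ d → d ∉ C → SideStep C d (α d)

  -- the face on the left of d lies in the interior of C
  Inside : Subset nD → Fin nD → Set
  Inside C d = ¬ Star (SideStep C) d dInf

  Alternating : Subset nD → Subset nD → Set
  Alternating M C = ∀ d d' → d ∈ C → d' ∈ C → tail d ≡ tail d' → d ≢ d' →
    (d ∈ M → d' ∉ M) × (d ∉ M → d' ∈ M)

  -- proper M-alternating cycle: each M-edge traversed white→black along the
  -- clockwise orientation (interior on the right; right face of d = left face of α d)
  ProperAlternatingCycle : Subset nD → Subset nD → Set
  ProperAlternatingCycle M C =
    IsCycle C × Alternating M C ×
    (∀ d → d ∈ C → d ∈ M → color (tail d) ≡ white → Inside C (α d))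

  IsBottomMatching : Subset nD → Set
  IsBottomMatching M0 = PerfectMatching M0 × (∀ C → ¬ ProperAlternatingCycle M0 C)

  SubsetOfSymDiff : Subset nD → Subset nD → Subset nD → Set
  SubsetOfSymDiff M M0 C = ∀ d → d ∈ C → (d ∈ M × d ∉ M0) ⊎ (d ∉ M × d ∈ M0)

  PhiFaceIs : Subset nD → Subset nD → Fin nD → ℕ → Set
  PhiFaceIs M0 M f k = CountIs (λ C → IsCycle C × SubsetOfSymDiff M M0 C × Inside C f) k

  bit : Bool → ℕ
  bit false = 0
  bit true  = 1

  module _ (n : ℕ) (s : Fin n → Fin nD) where

    PhiIs : Subset nD → Subset nD → Vec Bool n → Set
    PhiIs M0 M x = ∀ i → PhiFaceIs M0 M (s i) (bit (lookup x i))

    -- d (as an edge) belongs to G_k = union of boundaries of s_1..s_k (0-indexed s_j, j<k)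
    InG : ℕ → Fin nD → Set
    InG k d = ∃[ j ] (toℕ j < k × (SameFace (s j) d ⊎ SameFace (s j) (α d)))

    InV : ℕ → Fin nV → Set
    InV k v = ∃[ d ] (InG k d × tail d ≡ v)

    Adj : Fin n → Fin n → Set
    Adj j i = ∃[ d ] (SameFace (s j) d × SameFace (s i) (α d))

    -- g : last dart of G_k on the boundary walk of the new face s_i (k = toℕ i)
    -- before the new path P starts; head g is the end of P reached last along the
    -- clockwise orientation of the periphery of G_{k+1}.
    RunStart : Fin n → Fin nD → Set
    RunStart i g = SameFace (s i) g × InG (toℕ i) g × ¬ InG (toℕ i) (φ g)

    RunEnd : Fin n → Fin nD → Set
    RunEnd i e = SameFace (s i) e × ¬ InG (toℕ i) e × InG (toℕ i) (φ e)

    -- along the clockwise orientation of the periphery of G_{i+1}, the ends of P_{i+1}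
    -- are coloured white and black respectively
    WhiteBlack : Fin n → Set
    WhiteBlack i = ∃[ g ] (RunStart i g × color (head g) ≡ black)

    -- reducible face decomposition associated with s_1, …, s_n (0-indexed here)
    IsRFD : Set
    IsRFD =
      (∀ i j → SameFace (s i) (s j) → i ≡ j) ×
      (∀ i → ¬ SameFace dInf (s i)) ×
      (∀ d → ¬ SameFace dInf d → ∃[ i ] SameFace (s i) d) ×
      (∀ i → FacialCycle (s i)) ×
      (∀ i → 1 ≤ toℕ i →
         -- the boundary edges of s_i not in G_{i-1} form one path P_i ...
         (∃[ g ] (RunStart i g × (∀ g' → RunStart i g' → g' ≡ g))) ×
         -- ... meeting G_{i-1} exactly in its end vertices ...
         (∀ d → SameFace (s i) d → ¬ InG (toℕ i) d → ¬ InG (toℕ i) (φ d) →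
            ¬ InV (toℕ i) (head d)) ×
         -- ... of odd length
         (∀ g e → RunStart i g → RunEnd i e → color (head g) ≢ color (head e))) ×
      (∀ d → InG n d)

    data InL : (k : ℕ) → Vec Bool k → Set where
      base : ∀ b → InL 1 (b ∷ [])
      wb0  : ∀ i {x} → InL (toℕ i) x → WhiteBlack i → InL (suc (toℕ i)) (x ∷ʳ false)
      wb1  : ∀ i {x} → InL (toℕ i) x → WhiteBlack i →
             (∀ j (q : toℕ j < toℕ i) → Adj j i → lookup x (fromℕ< q) ≡ true) →
             InL (suc (toℕ i)) (x ∷ʳ true)
      bw1  : ∀ i {x} → InL (toℕ i) x → ¬ WhiteBlack i → InL (suc (toℕ i)) (x ∷ʳ true)
      bw0  : ∀ i {x} → InL (toℕ i) x → ¬ WhiteBlack i →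
             (∀ j (q : toℕ j < toℕ i) → Adj j i → lookup x (fromℕ< q) ≡ false) →
             InL (suc (toℕ i)) (x ∷ʳ false)

{-# OPTIONS --safe #-}
module Submission where

-- For perfect matchings M and M0 the difference M − M0, signed by the colour of the tail of
-- each dart, is a flow; peeling off s_n, …, s_1 shows that every flow is the difference of a
-- height function on the faces that vanishes on the infinite face.  Since M0 is the bottom
-- matching, a cycle C of M ⊕ M0 gives M0 ⊕ C the height 1 inside C and 0 outside, so the height
-- of M counts the cycles around a face: it is φ_M, and it is nonnegative.  Elementarity then
-- forces M0 to match the periphery by its edges that leave black vertices clockwise.  If some
-- height were at least 2, switching M0 along the boundary of {height ≥ 2} would change M0 inside
-- the periphery only, against the forcing hypothesis; hence φ_M takes the values 0 and 1.
--
-- On the common path Q_i of s_i with G_{i−1}, the edges in even position match exactly the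
-- vertices that become interior when s_i is added.  Over all i they form a perfect matching of
-- the interior of G, which by forcing is the rest of M0.  So M0 alternates on every Q_i, and the
-- condition for a 0-1 height function to come from a matching, which on each edge is an
-- inequality whose direction depends on M0, is the rule defining L_i from L_{i−1}.

open import Defs
open import Data.Nat as ℕ using (ℕ; zero; suc; z≤n; s≤s; _≤_)
import Data.Nat.Properties as ℕₚ
open import Data.Nat.DivMod using (_%_; _/_; m≡m%n+[m/n]*n; m%n<n)
open import Data.Nat.Induction using (<-wellFounded)
open import Induction.WellFounded using (Acc; acc)
open import Data.Integer as ℤ using (ℤ; 0ℤ; 1ℤ; -1ℤ; +_; -[1+_]; _+_; -_; +≤+)
import Data.Integer.Properties as ℤₚ
open import Data.Integer.Tactic.RingSolver using (solve-∀)
open import Data.Fin as Fin using (Fin; zero; suc; toℕ; fromℕ<)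
open import Data.Fin.Properties as Finₚ
  using (_≟_; any?; pigeonhole; toℕ-injective; toℕ<n; toℕ-fromℕ<; fromℕ<-toℕ)
open import Data.Fin.Permutation using (Permutation; permutation)
open import Data.Bool as Bool using (Bool; true; false; if_then_else_)
open import Data.Vec as Vec using (Vec; []; _∷_; _∷ʳ_; lookup; tabulate)
open import Data.Vec.Properties using (lookup∘tabulate; lookup⇒[]=; []=⇒lookup)
import Data.Vec.Functional as VF
open import Data.List using ([]; _∷_)
open import Data.List.Relation.Unary.All using ([]; _∷_)
open import Data.List.Relation.Unary.AllPairs using ([]; _∷_)
open import Data.List.Relation.Unary.Any using (here)
open import Data.Fin.Subset using (Subset; _∈_; _∉_; _⊆_; _⊂_; ∣_∣)
open import Data.Fin.Subset.Properties using (_∈?_; ⊆-antisym; p⊂q⇒∣p∣<∣q∣)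
open import Data.Product using (Σ-syntax; ∃-syntax; _×_; _,_; proj₁; proj₂)
open import Data.Sum as Sum using (_⊎_; inj₁; inj₂; [_,_])
open import Data.Empty using (⊥; ⊥-elim)
open import Function using (_∘_; id)
open import Relation.Nullary using (¬_; Dec; yes; no; does; contradiction)
open import Relation.Nullary.Decidable using (⌊_⌋; ¬?; _×-dec_; _⊎-dec_; map′; dec-true)
open import Relation.Binary using (tri<; tri≈; tri>)
open import Relation.Binary.PropositionalEquality hiding ([_])
open import Relation.Binary.Construct.Closure.ReflexiveTransitive as Star using (Star; ε; _◅_; _◅◅_)
open import Algebra.Properties.CommutativeMonoid.Sum ℤₚ.+-0-commutativeMonoid
  using (sum; sum-cong-≗; ∑-distrib-+; sum-permute; sum-remove; sum-replicate-zero)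

-- That a cycle has an interior is not presupposed: `Inside` only says that the infinite face cannot
-- be reached. Turning around the vertices of a cycle shows that it has at most two sides. That
-- there are two comes from a potential that jumps across its edges, and potentials come from the
-- face decomposition. Heights also replace the counts defining φ_M whenever matchings are compared,
-- since they are additive when a cycle is split off and can be checked edge by edge. The threshold
-- 2 is chosen because heights change by at most 1 across an edge: the boundary of {height ≥ 2} then
-- stays away from the periphery, where the height starts at 0. The vertices that become interior
-- with s_i are recognised by comparing the indices of the faces around a vertex, the infinite face
-- counting as the last. Such a vertex has s_i as its face of largest index, and the corners already
-- present before s_i form at most one run in the rotation around it.

iter-shift : {A : Set} (f : A → A) (k : ℕ) (a : A) → iter f (suc k) a ≡ iter f k (f a)
iter-shift f zero    a = refl
iter-shift f (suc k) a = cong f (iter-shift f k a)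

iter-+ : {A : Set} (f : A → A) (k l : ℕ) (a : A) → iter f (k ℕ.+ l) a ≡ iter f k (iter f l a)
iter-+ f zero    l a = refl
iter-+ f (suc k) l a = cong f (iter-+ f k l a)

-- Orbits of an injection on a finite set

module Orbit {N} (f : Fin N → Fin N) (f-inj : ∀ {a b} → f a ≡ f b → a ≡ b) where

  Reach : Fin N → Fin N → Set
  Reach a b = ∃[ k ] iter f k a ≡ b

  iter-inj : ∀ k {a b} → iter f k a ≡ iter f k b → a ≡ b
  iter-inj zero    e = e
  iter-inj (suc k) e = iter-inj k (f-inj e)

  period : ∀ a → ∃[ p ] iter f (suc p) a ≡ a
  period a with pigeonhole (ℕₚ.n<1+n N) (λ i → iter f (toℕ i) a)
  ... | i , j , i<j , e = toℕ j ℕ.∸ suc (toℕ i) ,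
        sym (iter-inj (toℕ i) (trans e (trans (cong (λ m → iter f m a) split) (iter-+ f (toℕ i) _ a))))
    where
    split : toℕ j ≡ toℕ i ℕ.+ suc (toℕ j ℕ.∸ suc (toℕ i))
    split = sym (trans (ℕₚ.+-suc (toℕ i) _) (ℕₚ.m+[n∸m]≡n i<j))

  iter-multiple : ∀ a p → iter f (suc p) a ≡ a → ∀ q → iter f (q ℕ.* suc p) a ≡ a
  iter-multiple a p e zero    = refl
  iter-multiple a p e (suc q) =
    trans (iter-+ f (suc p) (q ℕ.* suc p) a) (trans (cong (iter f (suc p)) (iter-multiple a p e q)) e)

  reach-refl : ∀ {a} → Reach a a
  reach-refl = 0 , refl

  reach-trans : ∀ {a b c} → Reach a b → Reach b c → Reach a c
  reach-trans {a} (k , e) (l , e') = l ℕ.+ k , trans (iter-+ f l k a) (trans (cong (iter f l) e) e')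

  reach-step : ∀ {a} → Reach a (f a)
  reach-step = 1 , refl

  reach-sym : ∀ {a b} → Reach a b → Reach b a
  reach-sym {a} {b} (k , e) with period a
  -- The k steps from `a` to `b` followed by k * p more make k full periods of length `suc p`, so
  -- they end at `a`.
  ... | p , pe = k ℕ.* p ,
    trans (cong (iter f (k ℕ.* p)) (sym e))
      (trans (sym (iter-+ f (k ℕ.* p) k a))
        (trans (cong (λ m → iter f m a) (trans (ℕₚ.+-comm (k ℕ.* p) k) (sym (ℕₚ.*-suc k p))))
          (iter-multiple a p pe k)))

  -- Exponents matter only modulo the period of `a`, which leaves finitely many candidates.
  reach? : ∀ a b → Dec (Reach a b)
  reach? a b with period a
  ... | p , pe = map′ (λ (r , e) → toℕ r , e) bound (any? {n = suc p} λ r → iter f (toℕ r) a ≟ b)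
    where
    bound : Reach a b → ∃[ r ] iter f (toℕ {suc p} r) a ≡ b
    bound (k , e) = fromℕ< (m%n<n k (suc p)) ,
      trans (cong (λ m → iter f m a) (toℕ-fromℕ< (m%n<n k (suc p))))
        (trans (cong (iter f (k % suc p)) (sym (iter-multiple a p pe (k / suc p))))
          (trans (sym (iter-+ f (k % suc p) (k / suc p ℕ.* suc p) a))
            (trans (cong (λ m → iter f m a) (sym (m≡m%n+[m/n]*n k (suc p)))) e)))

  predecessor : ∀ b → ∃[ a ] (f a ≡ b × Reach b a)
  predecessor b with period b
  ... | p , e = iter f p b , e , (p , refl)

-- Decidable subsets, integer sums, signs from colours

module _ {N : ℕ} {P : Fin N → Set} (P? : ∀ d → Dec (P d)) where

  fromDec : Subset N
  fromDec = tabulate (λ d → does (P? d))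

  ∈-fromDec⁺ : ∀ {d} → P d → d ∈ fromDec
  ∈-fromDec⁺ {d} p = lookup⇒[]= d fromDec (trans (lookup∘tabulate _ d) (dec-true (P? d) p))

  ∈-fromDec⁻ : ∀ {d} → d ∈ fromDec → P d
  ∈-fromDec⁻ {d} m with P? d in eq
  ... | yes p = p
  ... | no ¬p = contradiction
    (trans (sym ([]=⇒lookup m)) (trans (lookup∘tabulate _ d) (cong does eq))) λ ()

indicator : Bool → ℤ
indicator b = if b then 1ℤ else 0ℤ

sum-zero : ∀ {N} (g : Fin N → ℤ) → (∀ d → g d ≡ 0ℤ) → sum g ≡ 0ℤ
sum-zero {N} g z = trans (sum-cong-≗ z) (sum-replicate-zero N)

sum-nonneg : ∀ {N} (g : Fin N → ℤ) → (∀ d → 0ℤ ℤ.≤ g d) → 0ℤ ℤ.≤ sum g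
sum-nonneg {zero}  g p = ℤₚ.≤-refl
sum-nonneg {suc N} g p = ℤₚ.+-mono-≤ (p zero) (sum-nonneg (g ∘ suc) (p ∘ suc))

sum-member : ∀ {N} (g : Fin N → ℤ) → (∀ d → 0ℤ ℤ.≤ g d) → ∀ a → g a ℤ.≤ sum g
sum-member {suc N} g p a =
  subst₂ ℤ._≤_ (ℤₚ.+-identityʳ (g a)) (sym (sum-remove {i = a} g))
    (ℤₚ.+-monoʳ-≤ (g a) (sum-nonneg (VF.removeAt g a) (λ d → p _)))

sum-single : ∀ {N} (g : Fin N → ℤ) a → (∀ d → d ≢ a → g d ≡ 0ℤ) → sum g ≡ g a
sum-single {suc N} g a z =
  trans (sum-remove {i = a} g)
    (trans (cong (_+_ (g a)) (sum-zero (VF.removeAt g a) (λ d → z _ (Finₚ.punchInᵢ≢i a d))))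
      (ℤₚ.+-identityʳ (g a)))

sgn : Color → ℤ → ℤ
sgn white z = z
sgn black z = - z

sgn-+ : ∀ c y z → sgn c (y + z) ≡ sgn c y + sgn c z
sgn-+ white y z = refl
sgn-+ black y z = ℤₚ.neg-distrib-+ y z

sgn-opposite : ∀ {c c'} → c ≢ c' → ∀ z → sgn c' z ≡ - sgn c z
sgn-opposite {white} {white} ne z = contradiction refl ne
sgn-opposite {white} {black} ne z = refl
sgn-opposite {black} {white} ne z = sym (ℤₚ.neg-involutive z)
sgn-opposite {black} {black} ne z = contradiction refl ne

_≟ᶜ_ : (c c' : Color) → Dec (c ≡ c')
white ≟ᶜ white = yes refl
white ≟ᶜ black = no λ ()
black ≟ᶜ white = no λ ()
black ≟ᶜ black = yes refl

opposite-unique : ∀ {a b c : Color} → a ≢ b → a ≢ c → b ≡ c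
opposite-unique {white} {white} p q = contradiction refl p
opposite-unique {white} {black} {white} p q = contradiction refl q
opposite-unique {white} {black} {black} p q = refl
opposite-unique {black} {white} {white} p q = refl
opposite-unique {black} {white} {black} p q = contradiction refl q
opposite-unique {black} {black} p q = contradiction refl p

-- Flows on darts and height functions on faces

module Map (G : PlaneBipartiteGraph) where
  open PlaneBipartiteGraph G public

  Dart : Set
  Dart = Fin nD

  α-inj : ∀ {d d'} → α d ≡ α d' → d ≡ d'
  α-inj {d} {d'} e = trans (sym (α-invol d)) (trans (cong α e) (α-invol d'))

  φ-inj : ∀ {d d'} → φ G d ≡ φ G d' → d ≡ d'
  φ-inj e = α-inj (σ-inj _ _ e)

  tail-φ : ∀ d → tail (φ G d) ≡ tail (α d)
  tail-φ d = σ-tail (α d)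

  φ-α : ∀ d → φ G (α d) ≡ σ d
  φ-α d = cong σ (α-invol d)

  open Orbit (φ G) φ-inj public renaming
    (reach? to sameFace?; reach-refl to sf-refl; reach-sym to sf-sym; reach-trans to sf-trans;
     reach-step to sf-step; predecessor to φ-predecessor)

  sf-φ : ∀ {a d} → SameFace G a d → SameFace G a (φ G d)
  sf-φ p = sf-trans p sf-step

  sf-φ⁻ : ∀ {a d} → SameFace G a (φ G d) → SameFace G a d
  sf-φ⁻ p = sf-trans p (sf-sym sf-step)

  sf-σ : ∀ {a d} → SameFace G a (α d) → SameFace G a (σ d)
  sf-σ {a} {d} p = subst (SameFace G a) (φ-α d) (sf-φ p)

  σ-permutation : Permutation nD nD
  σ-permutation = permutation σ σ⁻¹ σσ⁻¹ λ d → σ-inj _ _ (σσ⁻¹ (σ d))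
    where
    σ⁻¹ : Dart → Dart
    -- Rotation leads from `σ d` back to `d` in k steps, so k steps from `d` reach the dart
    -- preceding `d`.
    σ⁻¹ d = iter σ (proj₁ (σ-trans (σ d) d (σ-tail d))) d
    σσ⁻¹ : ∀ d → σ (σ⁻¹ d) ≡ d
    σσ⁻¹ d with σ-trans (σ d) d (σ-tail d)
    ... | k , e = trans (iter-shift σ k d) e

  atVertex : Fin nV → (Dart → ℤ) → Dart → ℤ
  atVertex v g d = if ⌊ tail d ≟ v ⌋ then g d else 0ℤ

  Σᵥ : Fin nV → (Dart → ℤ) → ℤ
  Σᵥ v g = sum (atVertex v g)

  atVertex-∈ : ∀ {v d} g → tail d ≡ v → atVertex v g d ≡ g d
  atVertex-∈ {v} {d} g e with tail d ≟ v
  ... | yes _ = refl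
  ... | no ne = contradiction e ne

  atVertex-zero : ∀ {v} g d → (tail d ≡ v → g d ≡ 0ℤ) → atVertex v g d ≡ 0ℤ
  atVertex-zero {v} g d z with tail d ≟ v
  ... | yes e = z e
  ... | no _ = refl

  Σᵥ-cong : ∀ {v} f g → (∀ d → tail d ≡ v → f d ≡ g d) → Σᵥ v f ≡ Σᵥ v g
  Σᵥ-cong {v} f g e = sum-cong-≗ pointwise
    where
    pointwise : ∀ d → atVertex v f d ≡ atVertex v g d
    pointwise d with tail d ≟ v
    ... | yes t = e d t
    ... | no _ = refl

  Σᵥ-+ : ∀ v f g → Σᵥ v (λ d → f d + g d) ≡ Σᵥ v f + Σᵥ v g
  Σᵥ-+ v f g = trans (sum-cong-≗ pointwise) (∑-distrib-+ (atVertex v f) (atVertex v g))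
    where
    pointwise : ∀ d → atVertex v (λ d → f d + g d) d ≡ atVertex v f d + atVertex v g d
    pointwise d with tail d ≟ v
    ... | yes t = refl
    ... | no _ = refl

  Σᵥ-σ : ∀ v g → Σᵥ v (g ∘ σ) ≡ Σᵥ v g
  Σᵥ-σ v g = trans (sum-cong-≗ pointwise) (sym (sum-permute (atVertex v g) σ-permutation))
    where
    pointwise : ∀ d → atVertex v (g ∘ σ) d ≡ atVertex v g (σ d)
    pointwise d rewrite σ-tail d = refl

  Σᵥ-single : ∀ {v} g a → tail a ≡ v → (∀ d → tail d ≡ v → d ≢ a → g d ≡ 0ℤ) → Σᵥ v g ≡ g a
  Σᵥ-single {v} g a e z =
    trans (sum-single (atVertex v g) a λ d ne → atVertex-zero g d λ t → z d t ne) (atVertex-∈ g e)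

  Σᵥ-zero : ∀ {v} g → (∀ d → tail d ≡ v → g d ≡ 0ℤ) → Σᵥ v g ≡ 0ℤ
  Σᵥ-zero g z = sum-zero _ λ d → atVertex-zero g d (z d)

  Σᵥ-pair : ∀ {v} g a b → tail a ≡ v → tail b ≡ v → a ≢ b →
            (∀ d → tail d ≡ v → d ≢ a → d ≢ b → g d ≡ 0ℤ) → Σᵥ v g ≡ g a + g b
  Σᵥ-pair {v} g a b ta tb a≢b z =
    trans (Σᵥ-cong g (λ d → here' d + elsewhere d) λ d _ → split d)
      (trans (Σᵥ-+ v here' elsewhere)
        (cong₂ _+_ (trans (Σᵥ-single here' a ta λ d _ ne → here'-≢ ne) here'-a)
                   (trans (Σᵥ-single elsewhere b tb others) (elsewhere-≢ (a≢b ∘ sym)))))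
    where
    here' elsewhere : Dart → ℤ
    here' d = if ⌊ d ≟ a ⌋ then g d else 0ℤ
    elsewhere d = if ⌊ d ≟ a ⌋ then 0ℤ else g d
    split : ∀ d → g d ≡ here' d + elsewhere d
    split d with d ≟ a
    ... | yes _ = sym (ℤₚ.+-identityʳ _)
    ... | no _ = sym (ℤₚ.+-identityˡ _)
    here'-≢ : ∀ {d} → d ≢ a → here' d ≡ 0ℤ
    here'-≢ {d} ne with d ≟ a
    ... | yes e = contradiction e ne
    ... | no _ = refl
    here'-a : here' a ≡ g a
    here'-a with a ≟ a
    ... | yes _ = refl
    ... | no ne = contradiction refl ne
    elsewhere-≢ : ∀ {d} → d ≢ a → elsewhere d ≡ g d
    elsewhere-≢ {d} ne with d ≟ a
    ... | yes e = contradiction e ne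
    ... | no _ = refl
    others : ∀ d → tail d ≡ v → d ≢ b → elsewhere d ≡ 0ℤ
    others d t ne with d ≟ a
    ... | yes _ = refl
    ... | no ne' = z d t ne' ne

  record IsFlow (f : Dart → ℤ) : Set where
    field
      antisymmetric : ∀ d → f (α d) ≡ - f d
      conserved     : ∀ v → Σᵥ v f ≡ 0ℤ
  open IsFlow public

  -- A function on faces, stored on darts: `ht d` belongs to the face left of `d`, and `ht (α d)` to
  -- the face right of it. The flow is the increase from left to right, so positive heights lie
  -- inside clockwise unit flows.
  record Potential (f : Dart → ℤ) : Set where
    field
      ht    : Dart → ℤ
      ht-φ  : ∀ d → ht (φ G d) ≡ ht d
      ht-∞  : ht dInf ≡ 0ℤ
      ht-α  : ∀ d → ht (α d) ≡ ht d + f d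
  open Potential public

  ht-σ : ∀ {f} (h : Potential f) d → ht h (σ d) ≡ ht h (α d)
  ht-σ h d = trans (cong (ht h) (sym (φ-α d))) (ht-φ h (α d))

  iter-const : ∀ {A : Set} (h : Dart → A) → (∀ d → h (φ G d) ≡ h d) → ∀ k d → h (iter (φ G) k d) ≡ h d
  iter-const h e zero    d = refl
  iter-const h e (suc k) d = trans (e _) (iter-const h e k d)

  ht-face : ∀ {f} (h : Potential f) {a d} → SameFace G a d → ht h d ≡ ht h a
  ht-face h (k , e) = trans (cong (ht h) (sym e)) (iter-const (ht h) (ht-φ h) k _)

  ht-∞-face : ∀ {f} (h : Potential f) {d} → SameFace G dInf d → ht h d ≡ 0ℤ
  ht-∞-face h p = trans (ht-face h p) (ht-∞ h)

  -- The face right of `d` is the face left of `σ d`. Around a vertex the sums over right and left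
  -- faces therefore differ only by a rotation and cancel.
  gradient-flow : ∀ (u : Dart → ℤ) → (∀ d → u (φ G d) ≡ u d) → IsFlow λ d → u (α d) + - u d
  gradient-flow u u-φ = record
    { antisymmetric = λ d → trans (cong (λ z → u z + - u (α d)) (α-invol d)) (flip (u d) (u (α d)))
    ; conserved = λ v →
        trans (Σᵥ-+ v (u ∘ α) (λ d → - u d))
          (trans (cong (_+ Σᵥ v (λ d → - u d))
                   (trans (Σᵥ-cong (u ∘ α) (u ∘ σ) λ d _ → sym (u-σ d)) (Σᵥ-σ v u)))
            (trans (sym (Σᵥ-+ v u (λ d → - u d))) (Σᵥ-zero _ λ d _ → ℤₚ.+-inverseʳ (u d))))
    }
    where
    flip : ∀ x y → x + - y ≡ - (y + - x)
    flip = solve-∀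
    u-σ : ∀ d → u (σ d) ≡ u (α d)
    u-σ d = trans (cong u (sym (φ-α d))) (u-φ (α d))

  flow-+ : ∀ {f g} → IsFlow f → IsFlow g → IsFlow λ d → f d + g d
  flow-+ {f} {g} F F' = record
    { antisymmetric = λ d → trans (cong₂ _+_ (antisymmetric F d) (antisymmetric F' d))
                              (sym (ℤₚ.neg-distrib-+ (f d) (g d)))
    ; conserved = λ v → trans (Σᵥ-+ v f g) (cong₂ _+_ (conserved F v) (conserved F' v))
    }

  ind : Subset nD → Dart → ℤ
  ind M d = indicator ⌊ d ∈? M ⌋

  ind-∈ : ∀ {M d} → d ∈ M → ind M d ≡ 1ℤ
  ind-∈ {M} {d} m with d ∈? M
  ... | yes _ = refl
  ... | no ¬m = contradiction m ¬m

  ind-∉ : ∀ {M d} → d ∉ M → ind M d ≡ 0ℤ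
  ind-∉ {M} {d} ¬m with d ∈? M
  ... | yes m = contradiction m ¬m
  ... | no _ = refl

  ind-cong : ∀ {M M' d d'} → (d ∈ M → d' ∈ M') → (d' ∈ M' → d ∈ M) → ind M d ≡ ind M' d'
  ind-cong {M} {M'} {d} {d'} f g with d ∈? M
  ... | yes m = sym (ind-∈ (f m))
  ... | no ¬m = sym (ind-∉ (¬m ∘ g))

  ind-injective : ∀ {M M' d} → ind M d ≡ ind M' d → d ∈ M → d ∈ M'
  ind-injective {M} {M'} {d} e m with d ∈? M'
  ... | yes m' = m'
  ... | no _ = contradiction (trans (sym (ind-∈ m)) e) λ ()

  module _ {M} (P : PerfectMatching G M) where

    matching-α : ∀ {d} → d ∈ M → α d ∈ M
    matching-α = proj₁ P _

    matching-α⁻ : ∀ {d} → α d ∈ M → d ∈ M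
    matching-α⁻ {d} m = subst (_∈ M) (α-invol d) (matching-α m)

    mate : Fin nV → Dart
    mate v = proj₁ (proj₂ P v)

    tail-mate : ∀ v → tail (mate v) ≡ v
    tail-mate v = proj₁ (proj₂ (proj₂ P v))

    mate-∈ : ∀ v → mate v ∈ M
    mate-∈ v = proj₁ (proj₂ (proj₂ (proj₂ P v)))

    mate-unique : ∀ {v d} → tail d ≡ v → d ∈ M → d ≡ mate v
    mate-unique {v} = proj₂ (proj₂ (proj₂ (proj₂ P v))) _

    matching-unique : ∀ {d d'} → d ∈ M → d' ∈ M → tail d ≡ tail d' → d ≡ d'
    matching-unique m m' e = trans (mate-unique e m) (sym (mate-unique refl m'))

  -- Edges gained by `M` carry one unit from white to black, edges lost from `M0` one unit from
  -- black to white. Common edges carry nothing.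
  flow : Subset nD → Subset nD → Dart → ℤ
  flow M M0 d = sgn (color (tail d)) (ind M d + - ind M0 d)

  flow-isFlow : ∀ {M M0} → PerfectMatching G M → PerfectMatching G M0 → IsFlow (flow M M0)
  flow-isFlow {M} {M0} P P0 = record
    { antisymmetric = λ d → trans (sgn-opposite (proper d) _)
        (cong (λ z → - sgn (color (tail d)) z)
          (cong₂ (λ y z → y + - z) (ind-cong (matching-α⁻ P) (matching-α P))
                                   (ind-cong (matching-α⁻ P0) (matching-α P0))))
    ; conserved = λ v →
        trans (Σᵥ-cong _ (λ d → sgn (color v) (ind M d) + sgn (color v) (- ind M0 d))
                (λ d t → trans (cong (λ w → sgn (color w) (ind M d + - ind M0 d)) t)
                               (sgn-+ (color v) (ind M d) (- ind M0 d))))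
          (trans (Σᵥ-+ v _ _)
            (trans (cong₂ _+_
              (trans (Σᵥ-single _ (mate P v) (tail-mate P v)
                       λ d t ne → trans (cong (sgn (color v)) (ind-∉ λ m → ne (mate-unique P t m))) (sgn-0 v))
                     (cong (sgn (color v)) (ind-∈ (mate-∈ P v))))
              (trans (Σᵥ-single _ (mate P0 v) (tail-mate P0 v)
                       λ d t ne → trans (cong (λ z → sgn (color v) (- z)) (ind-∉ λ m → ne (mate-unique P0 t m))) (sgn-0 v))
                     (cong (λ z → sgn (color v) (- z)) (ind-∈ (mate-∈ P0 v)))))
              (sgn-cancel v)))
    }
    where
    sgn-0 : ∀ v → sgn (color v) 0ℤ ≡ 0ℤ
    sgn-0 v with color v
    ... | white = refl
    ... | black = refl
    sgn-cancel : ∀ v → sgn (color v) 1ℤ + sgn (color v) -1ℤ ≡ 0ℤ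
    sgn-cancel v with color v
    ... | white = refl
    ... | black = refl

-- The symmetric difference of two perfect matchings

module SymmetricDifference (G : PlaneBipartiteGraph) where
  open Map G public

  SymDiff : Subset nD → Subset nD → Dart → Set
  SymDiff M M0 d = (d ∈ M × d ∉ M0) ⊎ (d ∉ M × d ∈ M0)

  symDiff? : ∀ M M0 d → Dec (SymDiff M M0 d)
  symDiff? M M0 d = ((d ∈? M) ×-dec ¬? (d ∈? M0)) ⊎-dec (¬? (d ∈? M) ×-dec (d ∈? M0))

  infixl 6 _⊖_
  _⊖_ : Subset nD → Subset nD → Subset nD
  M ⊖ C = fromDec (symDiff? M C)

  ⊖-keep : ∀ {M C d} → d ∈ M → d ∉ C → d ∈ M ⊖ C
  ⊖-keep {M} {C} m c = ∈-fromDec⁺ (symDiff? M C) (inj₁ (m , c))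

  ⊖-add : ∀ {M C d} → d ∉ M → d ∈ C → d ∈ M ⊖ C
  ⊖-add {M} {C} m c = ∈-fromDec⁺ (symDiff? M C) (inj₂ (m , c))

  ⊖-split : ∀ {M C d} → d ∈ M ⊖ C → SymDiff M C d
  ⊖-split {M} {C} = ∈-fromDec⁻ (symDiff? M C)

  ⊖-outside : ∀ {M C d} → d ∉ C → d ∈ M ⊖ C → d ∈ M
  ⊖-outside c m = [ proj₁ , (λ (_ , c') → contradiction c' c) ] (⊖-split m)

  ⊖-inside : ∀ {M C d} → d ∈ C → d ∈ M ⊖ C → d ∉ M
  ⊖-inside c m = [ (λ (_ , c') → contradiction c c') , proj₁ ] (⊖-split m)

  symDiff-sym : ∀ {M M0 d} → SymDiff M M0 d → SymDiff M0 M d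
  symDiff-sym = [ (λ (a , b) → inj₂ (b , a)) , (λ (a , b) → inj₁ (b , a)) ]

  flow-agree : ∀ {M M0 d} → (d ∈ M → d ∈ M0) → (d ∈ M0 → d ∈ M) → flow M M0 d ≡ 0ℤ
  flow-agree {M} {M0} {d} f g =
    trans (cong (λ z → sgn (color (tail d)) (z + - ind M0 d)) (ind-cong f g))
      (trans (cong (sgn (color (tail d))) (ℤₚ.+-inverseʳ (ind M0 d))) (sgn-0 (color (tail d))))
    where
    sgn-0 : ∀ c → sgn c 0ℤ ≡ 0ℤ
    sgn-0 white = refl
    sgn-0 black = refl

  flow-zero : ∀ {M M0 d} → ¬ SymDiff M M0 d → flow M M0 d ≡ 0ℤ
  flow-zero {M} {M0} {d} no-sd = flow-agree f g
    where
    f : d ∈ M → d ∈ M0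
    f m with d ∈? M0
    ... | yes m0 = m0
    ... | no ¬m0 = contradiction (inj₁ (m , ¬m0)) no-sd
    g : d ∈ M0 → d ∈ M
    g m0 with d ∈? M
    ... | yes m = m
    ... | no ¬m = contradiction (inj₂ (¬m , m0)) no-sd

  flow-gain : ∀ {M M0 d} → d ∈ M → d ∉ M0 → flow M M0 d ≡ sgn (color (tail d)) 1ℤ
  flow-gain {d = d} m m0 = cong₂ (λ y z → sgn (color (tail d)) (y + - z)) (ind-∈ m) (ind-∉ m0)

  flow-loss : ∀ {M M0 d} → d ∉ M → d ∈ M0 → flow M M0 d ≡ sgn (color (tail d)) -1ℤ
  flow-loss {d = d} m m0 = cong₂ (λ y z → sgn (color (tail d)) (y + - z)) (ind-∉ m) (ind-∈ m0)

  flow-unit : ∀ {M M0 d} → SymDiff M M0 d → flow M M0 d ≡ 1ℤ ⊎ flow M M0 d ≡ -1ℤ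
  flow-unit {d = d} (inj₁ (m , m0)) with color (tail d) | flow-gain m m0
  ... | white | e = inj₁ e
  ... | black | e = inj₂ e
  flow-unit {d = d} (inj₂ (m , m0)) with color (tail d) | flow-loss m m0
  ... | white | e = inj₂ e
  ... | black | e = inj₁ e

  flow-nonzero : ∀ {M M0 d} → SymDiff M M0 d → flow M M0 d ≢ 0ℤ
  flow-nonzero sd z with flow-unit sd
  ... | inj₁ e = contradiction (trans (sym e) z) λ ()
  ... | inj₂ e = contradiction (trans (sym e) z) λ ()

  module _ {M M0} (P : PerfectMatching G M) (P0 : PerfectMatching G M0) where

    symDiff-α : ∀ {d} → SymDiff M M0 d → SymDiff M M0 (α d)
    symDiff-α = Sum.map (λ (m , m0) → matching-α P m , m0 ∘ matching-α⁻ P0)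
                        (λ (m , m0) → m ∘ matching-α⁻ P , matching-α P0 m0)

    -- Of three darts of the difference at one vertex two belong to the same matching, hence
    -- coincide: the difference has degree at most 2.
    symDiff-third : ∀ {d d' d''} → SymDiff M M0 d → SymDiff M M0 d' → SymDiff M M0 d'' →
                    tail d' ≡ tail d → tail d'' ≡ tail d → d' ≢ d → d'' ≢ d → d' ≡ d''
    symDiff-third (inj₁ (a , _)) (inj₁ (b , _)) _ t' t'' ne' ne'' =
      contradiction (matching-unique P b a t') ne'
    symDiff-third (inj₁ (a , _)) (inj₂ _) (inj₁ (c , _)) t' t'' ne' ne'' =
      contradiction (matching-unique P c a t'') ne''
    symDiff-third (inj₁ (a , _)) (inj₂ (_ , b)) (inj₂ (_ , c)) t' t'' ne' ne'' =
      matching-unique P0 b c (trans t' (sym t''))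
    symDiff-third (inj₂ (_ , a)) (inj₂ (_ , b)) _ t' t'' ne' ne'' =
      contradiction (matching-unique P0 b a t') ne'
    symDiff-third (inj₂ (_ , a)) (inj₁ _) (inj₂ (_ , c)) t' t'' ne' ne'' =
      contradiction (matching-unique P0 c a t'') ne''
    symDiff-third (inj₂ (_ , a)) (inj₁ (b , _)) (inj₁ (c , _)) t' t'' ne' ne'' =
      matching-unique P b c (trans t' (sym t''))

    -- The other dart of the difference at the same vertex. Being the identity off the difference
    -- makes it an involution of all darts, so that `turn` is injective and has orbits.
    partner : Dart → Dart
    partner d with symDiff? M M0 d
    ... | yes (inj₁ _) = mate P0 (tail d)
    ... | yes (inj₂ _) = mate P (tail d)
    ... | no _ = d

    partner-fixed : ∀ {d} → ¬ SymDiff M M0 d → partner d ≡ d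
    partner-fixed {d} no-sd with symDiff? M M0 d
    ... | yes sd = contradiction sd no-sd
    ... | no _ = refl

    partner-tail : ∀ d → tail (partner d) ≡ tail d
    partner-tail d with symDiff? M M0 d
    ... | yes (inj₁ _) = tail-mate P0 (tail d)
    ... | yes (inj₂ _) = tail-mate P (tail d)
    ... | no _ = refl

    partner-≢ : ∀ {d} → SymDiff M M0 d → partner d ≢ d
    partner-≢ {d} sd e with symDiff? M M0 d
    ... | yes (inj₁ (_ , m0)) = m0 (subst (_∈ M0) e (mate-∈ P0 (tail d)))
    ... | yes (inj₂ (m , _)) = m (subst (_∈ M) e (mate-∈ P (tail d)))
    ... | no no-sd = no-sd sd

    partner-symDiff : ∀ {d} → SymDiff M M0 d → SymDiff M M0 (partner d)
    partner-symDiff {d} sd with symDiff? M M0 d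
    ... | yes (inj₁ (m , m0)) = inj₂
          ((λ m' → m0 (subst (_∈ M0) (matching-unique P m' m (tail-mate P0 (tail d))) (mate-∈ P0 (tail d)))) ,
           mate-∈ P0 (tail d))
    ... | yes (inj₂ (m , m0)) = inj₁
          (mate-∈ P (tail d) ,
           (λ m0' → m (subst (_∈ M) (matching-unique P0 m0' m0 (tail-mate P (tail d))) (mate-∈ P (tail d)))))
    ... | no no-sd = contradiction sd no-sd

    partner-involutive : ∀ d → partner (partner d) ≡ d
    partner-involutive d = by-cases (symDiff? M M0 d)
      where
      by-cases : Dec (SymDiff M M0 d) → partner (partner d) ≡ d
      by-cases (yes sd) =
        symDiff-third (partner-symDiff sd) (partner-symDiff (partner-symDiff sd)) sd
          (partner-tail (partner d)) (sym (partner-tail d)) (partner-≢ (partner-symDiff sd))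
          (partner-≢ sd ∘ sym)
      by-cases (no no-sd) = trans (cong partner (partner-fixed no-sd)) (partner-fixed no-sd)

    private
      turn : Dart → Dart
      turn d = partner (α d)

      turn-inj : ∀ {d d'} → turn d ≡ turn d' → d ≡ d'
      turn-inj {d} {d'} e = α-inj (trans (sym (partner-involutive (α d)))
        (trans (cong partner e) (partner-involutive (α d'))))

      module T = Orbit turn turn-inj

    private
      inOrbit? : ∀ c d → Dec (T.Reach c d ⊎ T.Reach c (α d))
      inOrbit? c d = T.reach? c d ⊎-dec T.reach? c (α d)

    -- An orbit of `turn` runs through its cycle in one direction only; the reversed darts complete
    -- it to a set of edges.
    component : Dart → Subset nD
    component c = fromDec (inOrbit? c)

    private
      component-join : ∀ {c d} → T.Reach c d ⊎ T.Reach c (α d) → d ∈ component c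
      component-join {c} = ∈-fromDec⁺ (inOrbit? c)

      component-split : ∀ {c d} → d ∈ component c → T.Reach c d ⊎ T.Reach c (α d)
      component-split {c} = ∈-fromDec⁻ (inOrbit? c)

    component-∋ : ∀ c → c ∈ component c
    component-∋ c = component-join (inj₁ T.reach-refl)

    component-⊆ : ∀ {c} → SymDiff M M0 c → SubsetOfSymDiff G M M0 (component c)
    component-⊆ {c} sd d m = [ orbit , back ∘ orbit ] (component-split m)
      where
      along-orbit : ∀ k → SymDiff M M0 (iter turn k c)
      along-orbit zero = sd
      along-orbit (suc k) = partner-symDiff (symDiff-α (along-orbit k))
      orbit : ∀ {d} → T.Reach c d → SymDiff M M0 d
      orbit (k , refl) = along-orbit k
      back : ∀ {d} → SymDiff M M0 (α d) → SymDiff M M0 d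
      back {d} x = subst (SymDiff M M0) (α-invol d) (symDiff-α x)

    component-isCycle : ∀ {c} → SymDiff M M0 c → IsCycle G (component c)
    component-isCycle {c} sd = closed , (c , component-∋ c) , two-regular , linked
      where
      C = component c
      closed : ∀ d → d ∈ C → α d ∈ C
      closed d m = [ (λ r → component-join (inj₂ (subst (T.Reach c) (sym (α-invol d)) r))) ,
                     (λ r → component-join (inj₁ r)) ] (component-split m)
      in-SD : ∀ {d} → d ∈ C → SymDiff M M0 d
      in-SD = component-⊆ sd _
      partner-∈ : ∀ {d} → d ∈ C → partner d ∈ C
      partner-∈ {d} m = [ before , after ] (component-split m)
        where
        after : T.Reach c (α d) → partner d ∈ C
        after r = component-join (inj₁ (subst (T.Reach c) (cong partner (α-invol d))
                    (T.reach-trans r T.reach-step)))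
        before : T.Reach c d → partner d ∈ C
        before r with T.predecessor d
        -- Here `d` is `partner (α e)`, so `partner d` is `α e`, the reversal of the dart that
        -- precedes `d` on the orbit.
        ... | e , refl , back = component-join (inj₂ (subst (T.Reach c)
                (sym (trans (cong α (partner-involutive (α e))) (α-invol e))) (T.reach-trans r back)))
      two-regular : ∀ d → d ∈ C → ∃[ d' ] (d' ∈ C × d' ≢ d × tail d' ≡ tail d ×
                      (∀ d'' → d'' ∈ C → tail d'' ≡ tail d → d'' ≡ d ⊎ d'' ≡ d'))
      two-regular d m = partner d , partner-∈ m , partner-≢ (in-SD m) , partner-tail d , only
        where
        only : ∀ d'' → d'' ∈ C → tail d'' ≡ tail d → d'' ≡ d ⊎ d'' ≡ partner d
        only d'' m'' t with d'' ≟ d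
        ... | yes e = inj₁ e
        ... | no ne = inj₂ (symDiff-third (in-SD m) (in-SD m'') (partner-symDiff (in-SD m))
                              t (partner-tail d) ne (partner-≢ (in-SD m)))
      step-sym : ∀ {d d'} → CycStep G C d d' → CycStep G C d' d
      step-sym (along d m) = subst (CycStep G C (α d)) (α-invol d) (along (α d) (closed d m))
      step-sym (pivot d d' m m' t) = pivot d' d m' m (sym t)
      walk : ∀ k → Star (CycStep G C) c (iter turn k c)
      walk zero = ε
      walk (suc k) = walk k ◅◅ along _ here' ◅ pivot _ _ (closed _ here') (partner-∈ (closed _ here'))
                       (sym (partner-tail _)) ◅ ε
        where here' = component-join (inj₁ (k , refl))
      on-orbit : ∀ {d} → T.Reach c d → Star (CycStep G C) c d
      on-orbit (k , refl) = walk k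
      from-c : ∀ {d} → d ∈ C → Star (CycStep G C) c d
      from-c {d} m = [ on-orbit , (λ r → on-orbit r ◅◅ step-sym (along d m) ◅ ε) ] (component-split m)
      linked : ∀ d d' → d ∈ C → d' ∈ C → Star (CycStep G C) d d'
      linked d d' m m' = Star.reverse step-sym (from-c m) ◅◅ from-c m'

    module _ {C} (closed : ∀ {d} → d ∈ C → α d ∈ C) (C⊆ : SubsetOfSymDiff G M M0 C)
             (full : ∀ {d d'} → d ∈ C → SymDiff M M0 d' → tail d' ≡ tail d → d' ∈ C) where

      -- Because `C` is full, at each vertex it contains either all darts of the difference or none.
      -- Switching thus trades the `M0`-edge for the `M`-edge or changes nothing there.
      toggle-matching : PerfectMatching G (M0 ⊖ C)
      toggle-matching = (λ d → closed-⊖) , at-vertex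
        where
        closed-⊖ : ∀ {d} → d ∈ M0 ⊖ C → α d ∈ M0 ⊖ C
        closed-⊖ {d} m with ⊖-split m
        ... | inj₁ (m0 , c) = ⊖-keep (matching-α P0 m0) λ c' → c (subst (_∈ C) (α-invol d) (closed c'))
        ... | inj₂ (m0 , c) = ⊖-add (m0 ∘ matching-α⁻ P0) (closed c)
        at-vertex : ∀ v → ∃[ d ] (tail d ≡ v × d ∈ M0 ⊖ C × (∀ d' → tail d' ≡ v → d' ∈ M0 ⊖ C → d' ≡ d))
        at-vertex v with mate P0 v ∈? C
        ... | no c = mate P0 v , tail-mate P0 v , ⊖-keep (mate-∈ P0 v) c , unique
          where
          not-in-C : ∀ {d'} → tail d' ≡ v → ¬ (d' ∈ C)
          not-in-C {d'} t c' with mate P0 v ∈? M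
          ... | no m0∉ = c (full c' (inj₂ (m0∉ , mate-∈ P0 v)) (trans (tail-mate P0 v) (sym t)))
          ... | yes m0∈ with C⊆ d' c'
          ...   | inj₁ (m , m0) =
                  m0 (subst (_∈ M0) (matching-unique P m0∈ m (trans (tail-mate P0 v) (sym t))) (mate-∈ P0 v))
          ...   | inj₂ (m , m0) =
                  m (subst (_∈ M) (matching-unique P0 (mate-∈ P0 v) m0 (trans (tail-mate P0 v) (sym t))) m0∈)
          unique : ∀ d' → tail d' ≡ v → d' ∈ M0 ⊖ C → d' ≡ mate P0 v
          unique d' t m with ⊖-split m
          ... | inj₁ (m0 , _) = mate-unique P0 t m0
          ... | inj₂ (_ , c') = contradiction c' (not-in-C t)
        ... | yes c = mate P v , tail-mate P v , ⊖-add mate∉ mate∈C , unique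
          where
          mate0∉ : mate P0 v ∉ M
          mate0∉ m = [ (λ (_ , m0) → m0 (mate-∈ P0 v)) , (λ (m' , _) → m' m) ] (C⊆ _ c)
          mate∉ : mate P v ∉ M0
          mate∉ m0 = mate0∉ (subst (_∈ M) (mate-unique P0 (tail-mate P v) m0) (mate-∈ P v))
          mate∈C : mate P v ∈ C
          mate∈C = full c (inj₁ (mate-∈ P v , mate∉)) (trans (tail-mate P v) (sym (tail-mate P0 v)))
          unique : ∀ d' → tail d' ≡ v → d' ∈ M0 ⊖ C → d' ≡ mate P v
          unique d' t m with ⊖-split m
          ... | inj₁ (m0 , c') = contradiction (subst (_∈ C) (sym (mate-unique P0 t m0)) c) c'
          ... | inj₂ (m0 , c') with C⊆ d' c'
          ...   | inj₁ (m' , _) = mate-unique P t m'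
          ...   | inj₂ (_ , m0') = contradiction m0' m0

  -- On `C` the matching `M ⊖ C` agrees with `M0` and `M0 ⊖ C` with `M`; off `C` it is the other way
  -- round. So exactly one summand carries the flow.
  flow-split : ∀ {M M0 C} → SubsetOfSymDiff G M M0 C → ∀ d →
               flow M M0 d ≡ flow (M ⊖ C) M0 d + flow (M0 ⊖ C) M0 d
  flow-split {M} {M0} {C} C⊆ d with d ∈? C
  ... | no c = sym (trans (cong₂ _+_
          (cong (λ z → sgn (color (tail d)) (z + - ind M0 d)) (ind-cong (⊖-outside c) λ m → ⊖-keep m c))
          (flow-agree {M0 ⊖ C} {M0} (⊖-outside c) λ m → ⊖-keep m c))
        (ℤₚ.+-identityʳ _))
  ... | yes c = sym (trans (cong₂ _+_
          (flow-agree {M ⊖ C} {M0} to from)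
          (cong (λ z → sgn (color (tail d)) (z + - ind M0 d)) (ind-cong to' from')))
        (ℤₚ.+-identityˡ _))
    where
    to : d ∈ M ⊖ C → d ∈ M0
    to m = [ (λ (a , _) → contradiction a (⊖-inside c m)) , proj₂ ] (C⊆ d c)
    from : d ∈ M0 → d ∈ M ⊖ C
    from m0 = [ (λ (_ , b) → contradiction m0 b) , (λ (a , _) → ⊖-add a c) ] (C⊆ d c)
    to' : d ∈ M0 ⊖ C → d ∈ M
    to' m = [ proj₁ , (λ (_ , b) → contradiction b (⊖-inside c m)) ] (C⊆ d c)
    from' : d ∈ M → d ∈ M0 ⊖ C
    from' m = [ (λ (_ , b) → ⊖-add b c) , (λ (a , _) → contradiction m a) ] (C⊆ d c)

-- The two sides of a cycle

module Separation (G : PlaneBipartiteGraph) (connected : Connected G) where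
  open SymmetricDifference G public

  ht-back : ∀ {f} (h : Potential f) d → ht h d ≡ ht h (α d) + f (α d)
  ht-back h d = trans (cong (ht h) (sym (α-invol d))) (ht-α h (α d))

  -- Both vanish at `dInf`, and their increments agree along any walk through the connected map.
  -- This identifies heights that were built in different ways.
  potential-unique : ∀ {f g} → (∀ d → f d ≡ g d) → (h : Potential f) (h' : Potential g) →
                     ∀ d → ht h d ≡ ht h' d
  potential-unique {f} {g} f≡g h h' d = go (proj₂ connected d dInf)
    where
    across : ∀ d → ht h (α d) ≡ ht h' (α d) → ht h d ≡ ht h' d
    across d e = trans (ht-back h d) (trans (cong₂ _+_ e (f≡g (α d))) (sym (ht-back h' d)))
    go : ∀ {d} → Star (ConnStep G) d dInf → ht h d ≡ ht h' d
    go ε = trans (ht-∞ h) (sym (ht-∞ h'))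
    go (rev d ◅ st) = across d (go st)
    go (rot d ◅ st) = across d (trans (sym (ht-σ h d)) (trans (go st) (ht-σ h' d)))

  potential-+ : ∀ {f g} → Potential f → Potential g → Potential λ d → f d + g d
  potential-+ {f} {g} h h' = record
    { ht = λ d → ht h d + ht h' d
    ; ht-φ = λ d → cong₂ _+_ (ht-φ h d) (ht-φ h' d)
    ; ht-∞ = cong₂ _+_ (ht-∞ h) (ht-∞ h')
    ; ht-α = λ d → trans (cong₂ _+_ (ht-α h d) (ht-α h' d)) (interchange (ht h d) (f d) (ht h' d) (g d)) }
    where
    interchange : ∀ a b c d → a + b + (c + d) ≡ a + c + (b + d)
    interchange = solve-∀

  step-σ : ∀ C d → SideStep G C (α d) (σ d)
  step-σ C d = subst (SideStep G C (α d)) (φ-α d) (face (α d))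

  ht-side : ∀ {f C} (h : Potential f) → (∀ {d} → d ∉ C → f d ≡ 0ℤ) →
            ∀ {d d'} → Star (SideStep G C) d d' → ht h d ≡ ht h d'
  ht-side h z ε = refl
  ht-side h z (face d ◅ st) = trans (sym (ht-φ h d)) (ht-side h z st)
  ht-side h z (face⁻ d ◅ st) = trans (ht-φ h d) (ht-side h z st)
  ht-side h z (cross d d∉C ◅ st) =
    trans (sym (trans (ht-α h d) (trans (cong (_+_ (ht h d)) (z d∉C)) (ℤₚ.+-identityʳ _)))) (ht-side h z st)

  -- Rotating from `d`, the first other dart of `C` to appear is `d'`, and every edge passed before
  -- it may be crossed.
  rotate : ∀ {C d d'} → tail d ≡ tail d' → d ≢ d' →
           (∀ z → z ∈ C → tail z ≡ tail d → z ≡ d ⊎ z ≡ d') → Star (SideStep G C) (α d) d'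
  rotate {C} {d} {d'} t ne only = let (k , e) = σ-trans d d' t in go k d e ne refl ε
    where
    go : ∀ k y → iter σ k y ≡ d' → y ≢ d' → tail y ≡ tail d →
         Star (SideStep G C) (α d) (α y) → Star (SideStep G C) (α d) d'
    go zero y e y≢ _ _ = contradiction e y≢
    go (suc k) y e y≢ ty st with σ y ≟ d' | σ y ∈? C
    ... | yes e' | _ = st ◅◅ subst (SideStep G C (α y)) e' (step-σ C y) ◅ ε
    ... | no ne' | no c = go k (σ y) (trans (sym (iter-shift σ k y)) e) ne' (trans (σ-tail y) ty)
                            (st ◅◅ step-σ C y ◅ cross (σ y) c ◅ ε)
    ... | no ne' | yes c with only (σ y) c (trans (σ-tail y) ty)
    ...   | inj₂ e' = contradiction e' ne'
    -- The rotation supplied by `σ-trans` may make several turns. On meeting `d` again the path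
    -- starts afresh.
    ...   | inj₁ e' = go k (σ y) (trans (sym (iter-shift σ k y)) e) ne' (trans (σ-tail y) ty)
                        (subst (λ z → Star (SideStep G C) (α d) (α z)) (sym e') ε)

  module _ {C} (cyc : IsCycle G C) where

    cycle-α : ∀ {d} → d ∈ C → α d ∈ C
    cycle-α = proj₁ cyc _

    cycle-pair : ∀ {d d'} → d ∈ C → d' ∈ C → tail d ≡ tail d' → d ≢ d' →
                 ∀ z → z ∈ C → tail z ≡ tail d → z ≡ d ⊎ z ≡ d'
    cycle-pair {d} {d'} c c' t ne z cz tz with proj₁ (proj₂ (proj₂ cyc)) d c
    ... | p , _ , _ , _ , only with only z cz tz | only d' c' (sym t)
    ... | inj₁ e | _ = inj₁ e
    ... | inj₂ e | inj₁ e' = contradiction (sym e') ne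
    ... | inj₂ e | inj₂ e' = inj₂ (trans e (sym e'))

    side-sym : ∀ {d d'} → SideStep G C d d' → SideStep G C d' d
    side-sym (face d) = face⁻ d
    side-sym (face⁻ d) = face d
    side-sym (cross d c) = subst (SideStep G C (α d)) (α-invol d)
      (cross (α d) λ c' → c (subst (_∈ C) (α-invol d) (cycle-α c')))

    private
      _~_ : Dart → Dart → Set
      _~_ = Star (SideStep G C)

    SameSide OppositeSide : Dart → Dart → Set
    SameSide c c' = c ~ c' × α c ~ α c'
    OppositeSide c c' = c ~ α c' × α c ~ c'

    -- Reversing a dart exchanges its sides. A pivot does so as well, by `rotate` in both
    -- directions, since the two darts leave the same vertex. Hence each cycle has at most two
    -- sides.
    sides : ∀ {c c'} → Star (CycStep G C) c c' → SameSide c c' ⊎ OppositeSide c c'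
    sides ε = inj₁ (ε , ε)
    sides (along c _ ◅ st) with sides st
    ... | inj₁ (p , q) = inj₂ (subst (_~ _) (α-invol c) q , p)
    ... | inj₂ (p , q) = inj₁ (subst (_~ _) (α-invol c) q , p)
    sides (pivot c e c∈ e∈ t ◅ st) with c ≟ e
    ... | yes refl = sides st
    ... | no ne with rotate t ne (cycle-pair c∈ e∈ t ne)
                   | Star.reverse side-sym (rotate (sym t) (ne ∘ sym) (cycle-pair e∈ c∈ (sym t) (ne ∘ sym)))
                   | sides st
    ... | r | r' | inj₁ (p , q) = inj₂ (r' ◅◅ q , r ◅◅ p)
    ... | r | r' | inj₂ (p , q) = inj₁ (r' ◅◅ q , r ◅◅ p)

    nearby : ∀ d → ∃[ c ] (c ∈ C × d ~ c)
    nearby d = let (c , c∈) = proj₁ (proj₂ cyc) in go c∈ (proj₂ connected d c)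
      where
      across : ∀ d → ∃[ c ] (c ∈ C × α d ~ c) → ∃[ c ] (c ∈ C × d ~ c)
      across d (c , c∈ , st) with d ∈? C
      ... | yes d∈ = d , d∈ , ε
      ... | no d∉ = c , c∈ , cross d d∉ ◅ st
      go : ∀ {d c} → c ∈ C → Star (ConnStep G) d c → ∃[ c ] (c ∈ C × d ~ c)
      go c∈ ε = _ , c∈ , ε
      go c∈ (rev d ◅ st) = across d (go c∈ st)
      go c∈ (rot d ◅ st) = let (c' , c'∈ , p) = go c∈ st in across d (c' , c'∈ , step-σ C d ◅ p)

    module _ {f} (h : Potential f) (outside : ∀ {d} → d ∉ C → f d ≡ 0ℤ)
             (jump : ∀ {d} → d ∈ C → f d ≢ 0ℤ) where

      two-valued : ∀ {c} → c ∈ C → ∀ d → ht h d ≡ ht h c ⊎ ht h d ≡ ht h (α c)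
      two-valued c∈ d with nearby d
      ... | c' , c'∈ , st with sides (proj₂ (proj₂ (proj₂ cyc)) _ _ c∈ c'∈)
      ... | inj₁ (p , _) = inj₁ (trans (ht-side h outside st) (sym (ht-side h outside p)))
      ... | inj₂ (_ , q) = inj₂ (trans (ht-side h outside st) (sym (ht-side h outside q)))

      -- Both faces reach the cycle, which has at most two sides. If they reached opposite sides of
      -- an edge, their equal heights would make the flow on it vanish.
      jordan : ∀ {d d'} → ht h d ≡ ht h d' → Star (SideStep G C) d d'
      jordan {d} {d'} e with nearby d | nearby d'
      ... | c , c∈ , st | c' , c'∈ , st' with sides (proj₂ (proj₂ (proj₂ cyc)) _ _ c∈ c'∈)
      ... | inj₁ (p , _) = st ◅◅ p ◅◅ Star.reverse side-sym st'
      ... | inj₂ (_ , q) = contradiction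
            (sum-fixed (trans (sym (ht-α h c)) (trans (ht-side h outside q)
              (trans (sym (ht-side h outside st')) (trans (sym e) (ht-side h outside st))))))
            (jump c∈)
        where
        sum-fixed : ∀ {x y} → x + y ≡ x → y ≡ 0ℤ
        sum-fixed {x} {y} p = trans (isolate x y) (trans (cong (_+ - x) p) (ℤₚ.+-inverseʳ x))
          where
          isolate : ∀ x y → y ≡ x + y + - x
          isolate = solve-∀

    -- The cycle already has two darts at the vertex, and the difference has room for no more.
    cycle-full : ∀ {M M0} → PerfectMatching G M → PerfectMatching G M0 → SubsetOfSymDiff G M M0 C →
                 ∀ {d d'} → d ∈ C → SymDiff M M0 d' → tail d' ≡ tail d → d' ∈ C
    cycle-full P P0 C⊆ {d} {d'} c sd t with d' ≟ d
    ... | yes refl = c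
    ... | no ne with proj₁ (proj₂ (proj₂ cyc)) d c
    ... | p , p∈ , p≢ , tp , _ = subst (_∈ C) (symDiff-third P P0 (C⊆ d c) (C⊆ p p∈) sd tp t p≢ ne) p∈

    -- A walk along `C'` that starts at the common dart can never leave `C`, by fullness.
    cycles-overlap : ∀ {M M0 C' c} → PerfectMatching G M → PerfectMatching G M0 →
                     SubsetOfSymDiff G M M0 C → IsCycle G C' → SubsetOfSymDiff G M M0 C' →
                     c ∈ C → c ∈ C' → C' ⊆ C
    cycles-overlap {C' = C'} P P0 C⊆ cyc' C'⊆ c∈ c∈' {d} d∈' =
      go c∈ (proj₂ (proj₂ (proj₂ cyc')) _ d c∈' d∈')
      where
      go : ∀ {a b} → a ∈ C → Star (CycStep G C') a b → b ∈ C
      go a∈ ε = a∈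
      go a∈ (along _ _ ◅ st) = go (cycle-α a∈) st
      go a∈ (pivot _ b _ b∈' t ◅ st) = go (cycle-full P P0 C⊆ a∈ (C'⊆ b b∈') (sym t)) st

-- Potentials of flows, from the face decomposition

module Decomposition (G : PlaneBipartiteGraph) (connected : Connected G) (no-leaf : ∀ d → PlaneBipartiteGraph.σ G d ≢ d)
                     (n : ℕ) (s : Fin n → Fin (PlaneBipartiteGraph.nD G)) (rfd : IsRFD G n s) where
  open Separation G connected public

  face-injective : ∀ {i j} → SameFace G (s i) (s j) → i ≡ j
  face-injective = proj₁ rfd _ _

  face-finite : ∀ {i} → ¬ SameFace G dInf (s i)
  face-finite = proj₁ (proj₂ rfd) _

  finite-face : ∀ {d} → ¬ SameFace G dInf d → ∃[ i ] SameFace G (s i) d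
  finite-face = proj₁ (proj₂ (proj₂ rfd)) _

  facial : ∀ {i d d'} → SameFace G (s i) d → SameFace G (s i) d' → tail d ≡ tail d' → d ≡ d'
  facial = proj₁ (proj₂ (proj₂ (proj₂ rfd))) _ _ _

  module _ {i : Fin n} (1≤i : 1 ≤ toℕ i) where
    private path = proj₁ (proj₂ (proj₂ (proj₂ (proj₂ rfd)))) i 1≤i

    lastOld : Dart
    lastOld = proj₁ (proj₁ path)

    lastOld-run : RunStart G n s i lastOld
    lastOld-run = proj₁ (proj₂ (proj₁ path))

    lastOld-unique : ∀ {g} → RunStart G n s i g → g ≡ lastOld
    lastOld-unique = proj₂ (proj₂ (proj₁ path)) _

    path-interior : ∀ {d} → SameFace G (s i) d → ¬ InG G n s (toℕ i) d → ¬ InG G n s (toℕ i) (φ G d) →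
                    ¬ InV G n s (toℕ i) (head G d)
    path-interior = proj₁ (proj₂ path) _

    path-odd : ∀ {g e} → RunStart G n s i g → RunEnd G n s i e → color (head G g) ≢ color (head G e)
    path-odd = proj₂ (proj₂ path) _ _

  all-InG : ∀ d → InG G n s n d
  all-InG = proj₂ (proj₂ (proj₂ (proj₂ (proj₂ rfd))))

  sf-unique : ∀ {i j d} → SameFace G (s i) d → SameFace G (s j) d → i ≡ j
  sf-unique p q = face-injective (sf-trans p (sf-sym q))

  sf-not-∞ : ∀ {i d} → SameFace G (s i) d → ¬ SameFace G dInf d
  sf-not-∞ p q = face-finite (sf-trans q (sf-sym p))

  -- Otherwise `φ d` and `α d` would be darts of one facial cycle with the same tail, hence equal,
  -- and `α d` would be a leaf.
  two-sided : ∀ {i d} → SameFace G (s i) d → ¬ SameFace G (s i) (α d)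
  two-sided {i} {d} p q = no-leaf (α d) (facial (sf-φ p) q (tail-φ d))

  InG? : ∀ k d → Dec (InG G n s k d)
  InG? k d = any? λ j → (toℕ j ℕ.<? k) ×-dec (sameFace? (s j) d ⊎-dec sameFace? (s j) (α d))

  InG-α : ∀ {k d} → InG G n s k d → InG G n s k (α d)
  InG-α (j , j<k , inj₁ p) = j , j<k , inj₂ (subst (SameFace G (s j)) (sym (α-invol _)) p)
  InG-α (j , j<k , inj₂ p) = j , j<k , inj₁ p

  InG-positive : ∀ {k d} → InG G n s k d → 1 ≤ k
  InG-positive (j , j<k , _) = ℕₚ.≤-trans (s≤s z≤n) j<k

  InG-suc : ∀ {i d} → InG G n s (suc (toℕ i)) d →
            InG G n s (toℕ i) d ⊎ SameFace G (s i) d ⊎ SameFace G (s i) (α d)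
  InG-suc {i} (j , s≤s j≤i , p) with toℕ j ℕ.≟ toℕ i
  ... | no ne = inj₁ (j , ℕₚ.≤∧≢⇒< j≤i ne , p)
  ... | yes e with toℕ-injective e
  ...   | refl = inj₂ p

  -- At a vertex that is new with s_i only the two boundary edges of s_i can carry flow, so what
  -- enters by one leaves by the other.
  vertex-step : ∀ {i f} → IsFlow f → (∀ d → f d ≢ 0ℤ → InG G n s (suc (toℕ i)) d) →
                ∀ {x} → SameFace G (s i) x → ¬ InV G n s (toℕ i) (head G x) → f (φ G x) ≡ f x
  vertex-step {i} {f} F supp {x} p fresh =
    ℤₚ.i-j≡0⇒i≡j _ _ (trans (cong (_+_ (f (φ G x))) (sym (antisymmetric F x)))
      (trans (sym pair) (conserved F (head G x))))
    where
    others : ∀ d → tail d ≡ head G x → d ≢ φ G x → d ≢ α x → f d ≡ 0ℤ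
    others d t ne ne' with f d ℤ.≟ 0ℤ
    ... | yes z = z
    ... | no nz with InG-suc (supp d nz)
    ...   | inj₁ old = contradiction (d , old , t) fresh
    ...   | inj₂ (inj₁ q) = contradiction (facial q (sf-φ p) (trans t (sym (tail-φ x)))) ne
    ...   | inj₂ (inj₂ q) = contradiction
              (σ-inj _ _ (facial (sf-σ q) (sf-φ p) (trans (σ-tail d) (trans t (sym (tail-φ x)))))) ne'
    pair : Σᵥ (head G x) f ≡ f (φ G x) + f (α x)
    pair = Σᵥ-pair f (φ G x) (α x) (tail-φ x) refl (no-leaf (α x)) others

  constant-on-path : ∀ {i f} → IsFlow f → (∀ d → f d ≢ 0ℤ → InG G n s (suc (toℕ i)) d) →
                     ∃[ c ] (∀ d → SameFace G (s i) d → ¬ InG G n s (toℕ i) d → f d ≡ c)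
  constant-on-path {i} {f} F supp = [ cycle , path ] (positive? (toℕ i))
    where
    positive? : ∀ m → m ≡ 0 ⊎ 1 ≤ m
    positive? zero = inj₁ refl
    positive? (suc m) = inj₂ (s≤s z≤n)
    cycle : toℕ i ≡ 0 → ∃[ c ] (∀ d → SameFace G (s i) d → ¬ InG G n s (toℕ i) d → f d ≡ c)
    cycle e = f (s i) , λ d (t , eq) _ → trans (cong f (sym eq)) (go t)
      where
      go : ∀ t → f (iter (φ G) t (s i)) ≡ f (s i)
      go zero = refl
      go (suc t) = trans
        (vertex-step F supp (t , refl)
          λ (d , old , _) → contradiction (subst (1 ≤_) e (InG-positive old)) λ ())
        (go t)
    path : 1 ≤ toℕ i → ∃[ c ] (∀ d → SameFace G (s i) d → ¬ InG G n s (toℕ i) d → f d ≡ c)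
    path 1≤i = f (φ G g) , λ d p new → let (t , e) = sf-trans (sf-sym g-face) p in go t d e new
      where
      g = lastOld 1≤i
      g-face = proj₁ (lastOld-run 1≤i)
      go : ∀ t d → iter (φ G) t g ≡ d → ¬ InG G n s (toℕ i) d → f d ≡ f (φ G g)
      go zero d refl new = contradiction (proj₁ (proj₂ (lastOld-run 1≤i))) new
      go (suc t) d refl new with InG? (toℕ i) (iter (φ G) t g)
      -- The preceding dart is old and this one new, so the preceding dart is the unique start of
      -- the run: the walk has come back to the first new dart.
      ... | yes old = cong (f ∘ φ G) (lastOld-unique 1≤i (sf-trans g-face (t , refl) , old , new))
      ... | no new' = trans (vertex-step F supp on (path-interior 1≤i on new' new)) (go t _ refl new')
        where on = sf-trans g-face (t , refl)

  -- On the path added with s_i a flow has a constant value, which a multiple of the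
  -- boundary of s_i removes.
  peel : ∀ i → (∀ {f} → IsFlow f → (∀ d → f d ≢ 0ℤ → InG G n s (toℕ i) d) → Potential f) →
         ∀ {f} → IsFlow f → (∀ d → f d ≢ 0ℤ → InG G n s (suc (toℕ i)) d) → Potential f
  peel i smaller {f} F supp = record
    { ht = λ d → ht h d + - u d
    ; ht-φ = λ d → cong₂ (λ y z → y + - z) (ht-φ h d) (u-φ d)
    ; ht-∞ = cong₂ (λ y z → y + - z) (ht-∞ h) (u-out λ p → sf-not-∞ p sf-refl)
    ; ht-α = λ d → trans (cong (_+ - u (α d)) (ht-α h d)) (rearrange (ht h d) (f d) (u (α d)) (u d)) }
    where
    rearrange : ∀ x y z w → x + (y + (z + - w)) + - z ≡ x + - w + y
    rearrange = solve-∀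
    c = proj₁ (constant-on-path F supp)
    f≡c = proj₂ (constant-on-path F supp)
    u : Dart → ℤ
    u d = if ⌊ sameFace? (s i) d ⌋ then c else 0ℤ
    u-in : ∀ {d} → SameFace G (s i) d → u d ≡ c
    u-in {d} p with sameFace? (s i) d
    ... | yes _ = refl
    ... | no ¬p = contradiction p ¬p
    u-out : ∀ {d} → ¬ SameFace G (s i) d → u d ≡ 0ℤ
    u-out {d} ¬p with sameFace? (s i) d
    ... | yes p = contradiction p ¬p
    ... | no _ = refl
    u-φ : ∀ d → u (φ G d) ≡ u d
    u-φ d with sameFace? (s i) d
    ... | yes p = u-in (sf-φ p)
    ... | no ¬p = u-out (¬p ∘ sf-φ⁻)
    f' : Dart → ℤ
    f' d = f d + (u (α d) + - u d)
    f'-zero : ∀ d → ¬ InG G n s (toℕ i) d → f' d ≡ 0ℤ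
    f'-zero d new with sameFace? (s i) d | sameFace? (s i) (α d)
    ... | yes p | yes q = contradiction q (two-sided p)
    ... | yes p | no q = trans (cong (_+ (0ℤ + - c)) (f≡c d p new)) (cancel c)
      where cancel : ∀ c → c + (0ℤ + - c) ≡ 0ℤ
            cancel = solve-∀
    ... | no p | yes q = trans (cong (_+ (c + - 0ℤ)) fd) (cancel c)
      where cancel : ∀ c → - c + (c + - 0ℤ) ≡ 0ℤ
            cancel = solve-∀
            fd : f d ≡ - c
            fd = trans (sym (ℤₚ.neg-involutive (f d)))
                   (cong -_ (trans (sym (antisymmetric F d))
                     (f≡c (α d) q λ old → new (subst (InG G n s (toℕ i)) (α-invol d) (InG-α old)))))
    ... | no p | no q with f d ℤ.≟ 0ℤ
    ...   | yes z = trans (ℤₚ.+-identityʳ (f d)) z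
    ...   | no nz with InG-suc (supp d nz)
    ...     | inj₁ old = contradiction old new
    ...     | inj₂ (inj₁ p') = contradiction p' p
    ...     | inj₂ (inj₂ q') = contradiction q' q
    supp' : ∀ d → f' d ≢ 0ℤ → InG G n s (toℕ i) d
    supp' d nz with InG? (toℕ i) d
    ... | yes old = old
    ... | no new = contradiction (f'-zero d new) nz
    h : Potential f'
    h = smaller (flow-+ F (gradient-flow u u-φ)) supp'

  supported-potential : ∀ k → k ≤ n → ∀ {f} → IsFlow f → (∀ d → f d ≢ 0ℤ → InG G n s k d) → Potential f
  supported-potential zero _ {f} F supp = record
    { ht = λ _ → 0ℤ ; ht-φ = λ _ → refl ; ht-∞ = refl
    ; ht-α = λ d → sym (trans (ℤₚ.+-identityˡ (f d)) (zero-flow d)) }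
    where
    zero-flow : ∀ d → f d ≡ 0ℤ
    zero-flow d with f d ℤ.≟ 0ℤ
    ... | yes z = z
    ... | no nz = contradiction (InG-positive (supp d nz)) λ ()
  supported-potential (suc k) k<n {f} F supp =
    peel (fromℕ< k<n)
      (λ F' supp' → supported-potential k (ℕₚ.<⇒≤ k<n) F'
        (λ d → subst (λ m → InG G n s m d) (toℕ-fromℕ< k<n) ∘ supp' d))
      F (λ d → subst (λ m → InG G n s (suc m) d) (sym (toℕ-fromℕ< k<n)) ∘ supp d)

  potential : ∀ {f} → IsFlow f → Potential f
  potential F = supported-potential n ℕₚ.≤-refl F λ d _ → all-InG d

-- Heights of matchings above the bottom matching

zero-or-one : ∀ {z} → 0ℤ ℤ.≤ z → ¬ (+ 2 ℤ.≤ z) → z ≡ 0ℤ ⊎ z ≡ 1ℤ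
zero-or-one {+ 0} _ _ = inj₁ refl
zero-or-one {+ 1} _ _ = inj₂ refl
zero-or-one {+ suc (suc m)} _ small = contradiction (+≤+ (s≤s (s≤s z≤n))) small
zero-or-one { -[1+ _ ] } () _

module Heights (G : PlaneBipartiteGraph) (connected : Connected G) (no-leaf : ∀ d → PlaneBipartiteGraph.σ G d ≢ d)
               (n : ℕ) (s : Fin n → Fin (PlaneBipartiteGraph.nD G)) (rfd : IsRFD G n s)
               (M0 : Subset (PlaneBipartiteGraph.nD G)) (bottom : IsBottomMatching G M0) where
  open Decomposition G connected no-leaf n s rfd public

  P0 : PerfectMatching G M0
  P0 = proj₁ bottom

  height : ∀ {M} → PerfectMatching G M → Potential (flow M M0)
  height P = potential (flow-isFlow P P0)

  module CycleHeight {M C} (P : PerfectMatching G M) (cyc : IsCycle G C) (C⊆ : SubsetOfSymDiff G M M0 C) where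

    up : PerfectMatching G (M0 ⊖ C)
    up = toggle-matching P P0 (cycle-α cyc) C⊆ (cycle-full cyc P P0 C⊆)

    remainder : PerfectMatching G (M ⊖ C)
    remainder = toggle-matching P0 P (cycle-α cyc) (λ d c → symDiff-sym (C⊆ d c))
                  (λ c sd → cycle-full cyc P P0 C⊆ c (symDiff-sym sd))

    hC : Potential (flow (M0 ⊖ C) M0)
    hC = height up

    split : ∀ d → ht (height P) d ≡ ht (height remainder) d + ht hC d
    split = potential-unique (flow-split C⊆) (height P) (potential-+ (height remainder) hC)

    outside : ∀ {d} → d ∉ C → flow (M0 ⊖ C) M0 d ≡ 0ℤ
    outside c = flow-agree (⊖-outside c) λ m → ⊖-keep m c

    toggled : ∀ {d} → d ∈ C → SymDiff (M0 ⊖ C) M0 d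
    toggled {d} c with d ∈? M0
    ... | yes m0 = inj₂ ((λ m → ⊖-inside c m m0) , m0)
    ... | no m0 = inj₁ (⊖-add m0 c , m0)

    jump : ∀ {d} → d ∈ C → flow (M0 ⊖ C) M0 d ≢ 0ℤ
    jump c = flow-nonzero (toggled c)

    alternating : Alternating G M0 C
    alternating d d' c c' t ne =
      (λ m m' → ne (matching-unique P0 m m' t)) ,
      λ m → [ (λ (m' , _) → [ (λ (m'' , _) → contradiction (matching-unique P m' m'' t) ne) , proj₂ ] (C⊆ d' c')) ,
              (λ (_ , m') → contradiction m' m) ] (C⊆ d c)

    -- With values -1 and 0, no `M0`-edge of `C` directed from white to black can have the infinite
    -- side on its right, as its left side would then have height 1. So `C` would be a proper
    -- alternating cycle for the bottom matching.
    no-negative : ∀ {c} → c ∈ C → ht hC c ≡ -1ℤ → ht hC (α c) ≢ 0ℤ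
    no-negative {c} c∈ hc hαc = proj₂ bottom C (cyc , alternating , clockwise)
      where
      clockwise : ∀ e → e ∈ C → e ∈ M0 → color (tail e) ≡ white → Inside G C (α e)
      clockwise e e∈ m0 w st = impossible (two-valued cyc hC outside jump c∈ e)
        where
        loss : flow (M0 ⊖ C) M0 e ≡ -1ℤ
        loss = trans (flow-loss (λ m → ⊖-inside e∈ m m0) m0) (cong (λ k → sgn k -1ℤ) w)
        he : ht hC e + -1ℤ ≡ 0ℤ
        he = trans (cong (_+_ (ht hC e)) (sym loss)) (trans (sym (ht-α hC e))
               (trans (ht-side hC outside st) (ht-∞ hC)))
        impossible : ¬ (ht hC e ≡ ht hC c ⊎ ht hC e ≡ ht hC (α c))
        impossible (inj₁ p) = contradiction (trans (cong (_+ -1ℤ) (sym (trans p hc))) he) λ ()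
        impossible (inj₂ p) = contradiction (trans (cong (_+ -1ℤ) (sym (trans p hαc))) he) λ ()

    -- Of the two values one is 0, taken on the infinite face. The other differs from it by 1, and
    -- -1 is excluded.
    unit-height : ∀ d → ht hC d ≡ 0ℤ ⊎ ht hC d ≡ 1ℤ
    unit-height d with ht hC d ℤ.≟ 0ℤ
    ... | yes z = inj₁ z
    ... | no nz with nearby cyc d
    ... | c , c∈ , st with ht-side hC outside st | two-valued cyc hC outside jump c∈ dInf
    ... | e | inj₁ p = contradiction (trans e (trans (sym p) (ht-∞ hC))) nz
    ... | e | inj₂ p with flow-unit (toggled c∈)
    ...   | inj₂ f = inj₂ (trans e (trans (ℤₚ.i-j≡0⇒i≡j (ht hC c) 1ℤ
              (trans (cong (_+_ (ht hC c)) (sym f)) (trans (sym (ht-α hC c)) (trans (sym p) (ht-∞ hC))))) refl))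
    ...   | inj₁ f = contradiction (trans (sym p) (ht-∞ hC)) (no-negative c∈ (ℤₚ.i-j≡0⇒i≡j (ht hC c) -1ℤ
              (trans (cong (_+_ (ht hC c)) (sym f)) (trans (sym (ht-α hC c)) (trans (sym p) (ht-∞ hC))))))

    inside⁺ : ∀ {d} → ht hC d ≡ 1ℤ → Inside G C d
    inside⁺ e st = contradiction (trans (sym e) (trans (ht-side hC outside st) (ht-∞ hC))) λ ()

    -- A face of height 0 shares its height with the infinite face and so is joined to it without
    -- crossing `C`.
    inside⁻ : ∀ {d} → Inside G C d → ht hC d ≡ 1ℤ
    inside⁻ {d} ins with unit-height d
    ... | inj₂ e = e
    ... | inj₁ e = contradiction (jordan cyc hC outside jump (trans e (sym (ht-∞ hC)))) ins

    remainder-symDiff : ∀ {d} → SymDiff (M ⊖ C) M0 d → d ∉ C × SymDiff M M0 d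
    remainder-symDiff {d} sd with d ∈? C
    ... | no c = c , Sum.map (λ (x , y) → ⊖-outside c x , y) (λ (x , y) → (λ m → x (⊖-keep m c)) , y) sd
    ... | yes c with C⊆ d c | sd
    ...   | inj₁ (m , m0) | inj₁ (x , _) = contradiction m (⊖-inside c x)
    ...   | inj₁ (m , m0) | inj₂ (_ , y) = contradiction y m0
    ...   | inj₂ (m , m0) | inj₁ (_ , y) = contradiction m0 y
    ...   | inj₂ (m , m0) | inj₂ (x , _) = contradiction (⊖-add m c) x

  zero-potential : Potential λ _ → 0ℤ
  zero-potential = record { ht = λ _ → 0ℤ ; ht-φ = λ _ → refl ; ht-∞ = refl ; ht-α = λ _ → refl }

  CycleAround : Subset nD → Dart → Subset nD → Set
  CycleAround M d C = IsCycle G C × SubsetOfSymDiff G M M0 C × Inside G C d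

  -- Cycles are split off M ⊕ M0 one at a time; each of them has height 0 or 1 everywhere.
  zero-or-enclosed : ∀ {M} (P : PerfectMatching G M) d →
                     ht (height P) d ≡ 0ℤ ⊎ (1ℤ ℤ.≤ ht (height P) d × ∃[ C ] CycleAround M d C)
  zero-or-enclosed P d = go P (<-wellFounded _)
    where
    go : ∀ {M} (P : PerfectMatching G M) → Acc ℕ._<_ ∣ M ⊖ M0 ∣ →
         ht (height P) d ≡ 0ℤ ⊎ (1ℤ ℤ.≤ ht (height P) d × ∃[ C ] CycleAround M d C)
    go {M} P (acc smaller) with any? (symDiff? M M0)
    ... | no none = inj₁ (potential-unique (λ e → flow-zero λ sd → none (e , sd)) (height P) zero-potential d)
    ... | yes (c , sd) = combine (go remainder (smaller (p⊂q⇒∣p∣<∣q∣ decreasing))) (unit-height d)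
      where
      C = component P P0 c
      C⊆ = component-⊆ P P0 sd
      cyc = component-isCycle P P0 sd
      open CycleHeight P cyc C⊆
      -- The recursion ends because splitting off `C` removes at least `c` from the difference.
      decreasing : (M ⊖ C) ⊖ M0 ⊂ M ⊖ M0
      decreasing = (λ m → ∈-fromDec⁺ (symDiff? M M0) (proj₂ (remainder-symDiff (⊖-split m)))) ,
        c , ∈-fromDec⁺ (symDiff? M M0) sd ,
        λ m → proj₁ (remainder-symDiff (⊖-split m)) (component-∋ P P0 c)
      combine : ht (height remainder) d ≡ 0ℤ ⊎
                  (1ℤ ℤ.≤ ht (height remainder) d × ∃[ C' ] CycleAround (M ⊖ C) d C') →
                ht hC d ≡ 0ℤ ⊎ ht hC d ≡ 1ℤ →
                ht (height P) d ≡ 0ℤ ⊎ (1ℤ ℤ.≤ ht (height P) d × ∃[ C' ] CycleAround M d C')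
      combine (inj₁ p) (inj₁ q) = inj₁ (trans (split d) (cong₂ _+_ p q))
      combine (inj₁ p) (inj₂ q) =
        inj₂ (ℤₚ.≤-reflexive (sym (trans (split d) (cong₂ _+_ p q))) , C , cyc , C⊆ , inside⁺ q)
      combine (inj₂ (p , C' , cyc' , C'⊆ , ins)) q =
        inj₂ (subst (1ℤ ℤ.≤_) (sym (split d)) (ℤₚ.+-mono-≤ p (hC-nonneg q)) ,
              C' , cyc' , (λ e e∈ → proj₂ (remainder-symDiff (C'⊆ e e∈))) , ins)
        where
        hC-nonneg : ht hC d ≡ 0ℤ ⊎ ht hC d ≡ 1ℤ → 0ℤ ℤ.≤ ht hC d
        hC-nonneg (inj₁ e) = ℤₚ.≤-reflexive (sym e)
        hC-nonneg (inj₂ e) = subst (0ℤ ℤ.≤_) (sym e) (+≤+ z≤n)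

  height-nonneg : ∀ {M} (P : PerfectMatching G M) d → 0ℤ ℤ.≤ ht (height P) d
  height-nonneg P d with zero-or-enclosed P d
  ... | inj₁ e = ℤₚ.≤-reflexive (sym e)
  ... | inj₂ (p , _) = ℤₚ.≤-trans (+≤+ z≤n) p

  -- Turning from `d` to `d'` crosses no edge of the difference, and heights change only across such
  -- edges.
  symDiff-rotate : ∀ {M d d'} (P : PerfectMatching G M) → SymDiff M M0 d → SymDiff M M0 d' →
                   tail d ≡ tail d' → d ≢ d' → ht (height P) (α d) ≡ ht (height P) d'
  symDiff-rotate {M} {d} {d'} P sd sd' t ne =
    ht-side (height P) (λ no-sd → flow-zero λ x → no-sd (∈-fromDec⁺ (symDiff? M M0) x))
      (rotate {C = M ⊖ M0} t ne only)
    where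
    only : ∀ z → z ∈ M ⊖ M0 → tail z ≡ tail d → z ≡ d ⊎ z ≡ d'
    only z z∈ tz with z ≟ d
    ... | yes e = inj₁ e
    ... | no ne' = inj₂ (symDiff-third P P0 sd (⊖-split z∈) sd' tz (sym t) ne' (ne ∘ sym))

-- The forcing infinite face: heights are 0 or 1 and equal φ_M

module Forcing (G : PlaneBipartiteGraph) (connected : Connected G) (no-leaf : ∀ d → PlaneBipartiteGraph.σ G d ≢ d)
               (n : ℕ) (s : Fin n → Fin (PlaneBipartiteGraph.nD G)) (rfd : IsRFD G n s)
               (M0 : Subset (PlaneBipartiteGraph.nD G)) (bottom : IsBottomMatching G M0)
               (allowed : ∀ d → ∃[ M ] (PerfectMatching G M × d ∈ M))
               (forcing : ForcingInfiniteFace G) where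
  open Heights G connected no-leaf n s rfd M0 bottom public

  -- Were `d` outside `M0`, a perfect matching through `d` would have height -1 on the face across
  -- it.
  periphery-black : ∀ {d} → SameFace G dInf d → color (tail d) ≡ black → d ∈ M0
  periphery-black {d} p b with d ∈? M0
  ... | yes m0 = m0
  ... | no m0 with allowed d
  ... | M , P , m = contradiction (subst (0ℤ ℤ.≤_) below (height-nonneg P (α d))) λ ()
    where
    below : ht (height P) (α d) ≡ -1ℤ
    below = trans (ht-α (height P) d) (cong₂ _+_ (ht-∞-face (height P) p)
              (trans (flow-gain m m0) (cong (λ k → sgn k 1ℤ) b)))

  -- The preceding dart of the periphery leaves a black vertex, so its edge is in `M0` and matches
  -- the white vertex.
  periphery-white : ∀ {d} → SameFace G dInf d → color (tail d) ≡ white →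
                    ∃[ x ] (φ G x ≡ d × SameFace G dInf x × α x ∈ M0)
  periphery-white {d} p w with φ-predecessor d
  ... | x , refl , back = x , refl , sf-trans p back ,
        matching-α P0 (periphery-black (sf-trans p back) (opposite-unique (proper x ∘ sym) λ e →
          contradiction (trans (sym (trans (cong color (tail-φ x)) e)) w) λ ()))

  periphery-white-∉ : ∀ {d} → SameFace G dInf d → color (tail d) ≡ white → d ∉ M0
  periphery-white-∉ p w m0 with periphery-white p w
  ... | x , refl , _ , m0' = no-leaf (α x) (matching-unique P0 m0 m0' (tail-φ x))

  -- The peripheral edges in `M0` already cover all peripheral vertices. So no edge of `M0` joins
  -- the periphery to the interior.
  periphery-matched : ∀ {d} → OnPeriphery G (tail d) → d ∈ M0 → SameFace G dInf d ⊎ SameFace G dInf (α d)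
  periphery-matched {d} (p , on , t) m0 with color (tail p) in eq
  ... | black = inj₁ (subst (SameFace G dInf) (matching-unique P0 (periphery-black on eq) m0 t) on)
  ... | white with periphery-white on eq
  ...   | x , refl , on' , m0' = inj₂ (subst (SameFace G dInf)
            (trans (sym (α-invol x)) (cong α (matching-unique P0 m0' m0 (trans (sym (tail-φ x)) t)))) on')

  onPeriphery? : ∀ v → Dec (OnPeriphery G v)
  onPeriphery? v = any? λ d → sameFace? dInf d ×-dec (tail d ≟ v)

  periphery-α : ∀ {d} → SameFace G dInf (α d) → OnPeriphery G (tail d)
  periphery-α {d} p = σ d , sf-σ p , σ-tail d

  inner? : ∀ M d → Dec (d ∈ M × ¬ OnPeriphery G (tail d))
  inner? M d = (d ∈? M) ×-dec ¬? (onPeriphery? (tail d))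

  inner : Subset nD → Subset nD
  inner M = fromDec (inner? M)

  -- Agreement with `M0` at the periphery keeps the partners of inner vertices inside.
  inner-isMatching : ∀ {M} → PerfectMatching G M → (∀ {d} → d ∈ M → OnPeriphery G (tail d) → d ∈ M0) →
                     InnerPerfectMatching G (inner M)
  inner-isMatching {M} P agree =
    (λ d m → let (m' , off) = ∈-fromDec⁻ (inner? M) m in
             ∈-fromDec⁺ (inner? M) (matching-α P m' , λ on → off (from-head on (matching-α P m')))) ,
    (λ d m → proj₂ (∈-fromDec⁻ (inner? M) m)) ,
    λ v off → mate P v , tail-mate P v ,
      ∈-fromDec⁺ (inner? M) (mate-∈ P v , subst (λ w → ¬ OnPeriphery G w) (sym (tail-mate P v)) off) ,
      λ d t m → mate-unique P t (proj₁ (∈-fromDec⁻ (inner? M) m))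
    where
    from-head : ∀ {d} → OnPeriphery G (tail (α d)) → α d ∈ M → OnPeriphery G (tail d)
    from-head {d} on m with periphery-matched on (agree m on)
    ... | inj₁ p = periphery-α p
    ... | inj₂ p = d , subst (SameFace G dInf) (α-invol d) p , refl

  inner-unique : ∀ {N N'} → InnerPerfectMatching G N → InnerPerfectMatching G N' → N ≡ N'
  inner-unique p p' = let unique = proj₂ (proj₂ (proj₂ forcing)) in trans (unique _ p) (sym (unique _ p'))

  inner-M0 : InnerPerfectMatching G (inner M0)
  inner-M0 = inner-isMatching P0 λ m _ → m

  -- The boundary of {ht ≥ 2} avoids the periphery, so switching M0 along it would give
  -- a second inner matching.
  module HighLevel {M} (P : PerfectMatching G M) where

    h : Dart → ℤ
    h = ht (height P)

    High : Dart → Set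
    High d = + 2 ℤ.≤ h d

    high? : ∀ d → Dec (High d)
    high? d = + 2 ℤ.≤? h d

    boundary? : ∀ d → Dec ((High d × ¬ High (α d)) ⊎ (¬ High d × High (α d)))
    boundary? d = (high? d ×-dec ¬? (high? (α d))) ⊎-dec (¬? (high? d) ×-dec high? (α d))

    B : Subset nD
    B = fromDec boundary?

    B⊆ : SubsetOfSymDiff G M M0 B
    B⊆ d b with symDiff? M M0 d
    ... | yes sd = sd
    ... | no no-sd = [ (λ (x , y) → contradiction (subst (+ 2 ℤ.≤_) level x) y) ,
                       (λ (x , y) → contradiction (subst (+ 2 ℤ.≤_) (sym level) y) x) ] (∈-fromDec⁻ boundary? b)
      where
      level : h d ≡ h (α d)
      level = sym (trans (ht-α (height P) d) (trans (cong (_+_ (h d)) (flow-zero no-sd)) (ℤₚ.+-identityʳ _)))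

    B-α : ∀ {d} → d ∈ B → α d ∈ B
    B-α {d} b = ∈-fromDec⁺ boundary? (subst (λ z → (High (α d) × ¬ High z) ⊎ (¬ High (α d) × High z))
      (sym (α-invol d)) ([ (λ (x , y) → inj₂ (y , x)) , (λ (x , y) → inj₁ (y , x)) ] (∈-fromDec⁻ boundary? b)))

    -- Turning around the vertex gives both darts of the difference the same two heights at their
    -- sides, so they separate high from low together.
    B-full : ∀ {d d'} → d ∈ B → SymDiff M M0 d' → tail d' ≡ tail d → d' ∈ B
    B-full {d} {d'} b sd' t with d' ≟ d
    ... | yes refl = b
    ... | no ne = ∈-fromDec⁺ boundary?
          ([ (λ (x , y) → inj₂ ((λ z → y (subst (+ 2 ℤ.≤_) (sym right) z)) , subst (+ 2 ℤ.≤_) (sym left) x)) ,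
             (λ (x , y) → inj₁ (subst (+ 2 ℤ.≤_) right y , λ z → x (subst (+ 2 ℤ.≤_) left z))) ]
           (∈-fromDec⁻ boundary? b))
      where
      right : h (α d) ≡ h d'
      right = symDiff-rotate P (B⊆ d b) sd' (sym t) (ne ∘ sym)
      left : h (α d') ≡ h d
      left = symDiff-rotate P sd' (B⊆ d b) t ne

    -- The height changes by exactly 1 across an edge of the difference, so next to height 0 it
    -- cannot reach 2.
    ground-low : ∀ {d} → SymDiff M M0 d → h d ≡ 0ℤ ⊎ h (α d) ≡ 0ℤ → ¬ High d × ¬ High (α d)
    ground-low {d} sd (inj₁ e) with ht-α (height P) d | flow-unit sd
    ... | step | inj₁ f rewrite e | f | step = (λ { (+≤+ ()) }) , λ { (+≤+ (s≤s ())) }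
    ... | step | inj₂ f rewrite e | f | step = (λ { (+≤+ ()) }) , λ ()
    ground-low {d} sd (inj₂ e) with ht-back (height P) d | flow-unit (symDiff-α P P0 sd)
    ... | step | inj₁ f rewrite e | f | step = (λ { (+≤+ (s≤s ())) }) , λ { (+≤+ ()) }
    ... | step | inj₂ f rewrite e | f | step = (λ ()) , λ { (+≤+ ()) }

    B-off-periphery : ∀ {d} → d ∈ B → ¬ OnPeriphery G (tail d)
    B-off-periphery {d} b (p , on , t) =
      let (k , e) = σ-trans p d t
          (z , sd , tz , hz) = find k p e
      in low (z ≟ d) sd (trans tz t) (trans hz (ht-∞-face (height P) on))
      where
      -- Rotating from the corner on the infinite face, the first dart of the difference still has
      -- height 0 on its left. It is `d`, or else the only other such dart at this vertex, which
      -- then puts height 0 on the right of `d`.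
      find : ∀ k p → iter σ k p ≡ d → ∃[ z ] (SymDiff M M0 z × tail z ≡ tail p × h z ≡ h p)
      find k p e with symDiff? M M0 p
      find k p e | yes sd = p , sd , refl , refl
      find zero p refl | no no-sd = contradiction (B⊆ d b) no-sd
      find (suc k) p e | no no-sd with find k (σ p) (trans (sym (iter-shift σ k p)) e)
      ... | z , sd , tz , hz = z , sd , trans tz (σ-tail p) ,
            trans hz (trans (ht-σ (height P) p) (trans (ht-α (height P) p)
              (trans (cong (_+_ (h p)) (flow-zero no-sd)) (ℤₚ.+-identityʳ _))))
      not-boundary : ¬ (¬ High d × ¬ High (α d))
      not-boundary (x , y) = [ (λ (x' , _) → x x') , (λ (_ , y') → y y') ] (∈-fromDec⁻ boundary? b)
      low : ∀ {z} → Dec (z ≡ d) → SymDiff M M0 z → tail z ≡ tail d → h z ≡ 0ℤ → ⊥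
      low (yes refl) sd _ e = not-boundary (ground-low sd (inj₁ e))
      low (no ne) sd tz e = not-boundary (ground-low (B⊆ d b)
        (inj₂ (trans (symDiff-rotate P (B⊆ d b) sd (sym tz) (ne ∘ sym)) e)))

    B-empty : ∀ {d} → d ∉ B
    B-empty {d} b with d ∈? M0
    ... | yes m0 = ⊖-inside b (proj₁ (∈-fromDec⁻ (inner? (M0 ⊖ B)) (subst (d ∈_) same
                     (∈-fromDec⁺ (inner? M0) (m0 , B-off-periphery b))))) m0
      where same = inner-unique inner-M0 (inner-isMatching (toggle-matching P P0 B-α B⊆ B-full)
                     λ m on → ⊖-outside (λ b' → B-off-periphery b' on) m)
    ... | no m0 = m0 (proj₁ (∈-fromDec⁻ (inner? M0) (subst (d ∈_) (sym same)
                     (∈-fromDec⁺ (inner? (M0 ⊖ B)) (⊖-add m0 b , B-off-periphery b)))))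
      where same = inner-unique inner-M0 (inner-isMatching (toggle-matching P P0 B-α B⊆ B-full)
                     λ m on → ⊖-outside (λ b' → B-off-periphery b' on) m)

    nowhere-high : ∀ d → ¬ High d
    nowhere-high d high = go (proj₂ connected d dInf) high
      where
      across : ∀ {d} → High d → High (α d)
      across {d} x with high? (α d)
      ... | yes y = y
      ... | no y = contradiction (∈-fromDec⁺ boundary? (inj₁ (x , y))) B-empty
      go : ∀ {d} → Star (ConnStep G) d dInf → ¬ High d
      go ε x = contradiction (subst (+ 2 ℤ.≤_) (ht-∞ (height P)) x) λ { (+≤+ ()) }
      go (rev d ◅ st) x = go st (across x)
      go (rot d ◅ st) x = go st (subst (+ 2 ℤ.≤_) (sym (ht-σ (height P) d)) (across x))

  height-01 : ∀ {M} (P : PerfectMatching G M) d → ht (height P) d ≡ 0ℤ ⊎ ht (height P) d ≡ 1ℤ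
  height-01 P d = zero-or-one (height-nonneg P d) (HighLevel.nowhere-high P d)

  module _ {M} (P : PerfectMatching G M) {d : Dart} where

    -- Inside `C` the height is 1 plus that of the remainder, which is nonnegative; hence it is not
    -- 0.
    enclosed-height : ∀ {C} → CycleAround M d C → ht (height P) d ≡ 1ℤ
    enclosed-height (cyc , C⊆ , ins) with height-01 P d
    ... | inj₂ e = e
    ... | inj₁ e = contradiction (subst (1ℤ ℤ.≤_) e (subst (1ℤ ℤ.≤_) (sym (trans (split d) (cong (_+_ (ht (height remainder) d)) (inside⁻ ins))))
                     (ℤₚ.+-monoˡ-≤ 1ℤ (height-nonneg remainder d)))) λ { (+≤+ ()) }
      where open CycleHeight P cyc C⊆

  -- Two cycles of the difference with a common edge coincide, and two disjoint ones around the same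
  -- face would give it height 2.
  enclosing-unique : ∀ {M} (P : PerfectMatching G M) {d C C'} → CycleAround M d C → CycleAround M d C' → C ≡ C'
  enclosing-unique {M} P {d} {C} {C'} (cyc , C⊆ , ins) (cyc' , C'⊆ , ins') with any? (λ c → (c ∈? C) ×-dec (c ∈? C'))
  ... | yes (c , c∈ , c∈') = ⊆-antisym (cycles-overlap cyc' P P0 C'⊆ cyc C⊆ c∈' c∈)
                                       (cycles-overlap cyc P P0 C⊆ cyc' C'⊆ c∈ c∈')
  ... | no disjoint = contradiction (trans (sym (enclosed-height P (cyc , C⊆ , ins)))
          (trans (split d) (cong₂ _+_ (enclosed-height remainder (cyc' , C'⊆rest , ins')) (inside⁻ ins)))) λ ()
    where
    open CycleHeight P cyc C⊆
    C'⊆rest : SubsetOfSymDiff G (M ⊖ C) M0 C'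
    C'⊆rest e e∈ = Sum.map (λ (m , m0) → ⊖-keep m c∉ , m0) (λ (m , m0) → (m ∘ ⊖-outside c∉) , m0) (C'⊆ e e∈)
      where
      c∉ : e ∉ C
      c∉ c = disjoint (e , c , e∈)

  phi-height : ∀ {M} (P : PerfectMatching G M) d b → ht (height P) d ≡ indicator b → PhiFaceIs G M0 M d (bit G b)
  phi-height P d false e = [] , [] , [] ,
    (λ C around → contradiction (trans (sym e) (enclosed-height P around)) λ ()) , refl
  phi-height P d true e with zero-or-enclosed P d
  ... | inj₁ z = contradiction (trans (sym z) e) λ ()
  ... | inj₂ (_ , C , around) = (C ∷ []) , ([] ∷ []) , (around ∷ []) ,
        (λ C' around' → here (enclosing-unique P around' around)) , refl

  height-phi : ∀ {M} (P : PerfectMatching G M) d b → PhiFaceIs G M0 M d (bit G b) → ht (height P) d ≡ indicator b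
  height-phi P d false ([] , _ , _ , complete , _) with zero-or-enclosed P d
  ... | inj₁ z = z
  ... | inj₂ (_ , C , around) = contradiction (complete C around) λ ()
  height-phi P d true ((C ∷ _) , _ , (around ∷ _) , _ , _) = enclosed-height P around

-- The bottom matching on the old paths of the faces

module InnerMatching (G : PlaneBipartiteGraph) (connected : Connected G) (no-leaf : ∀ d → PlaneBipartiteGraph.σ G d ≢ d)
                     (n : ℕ) (s : Fin n → Fin (PlaneBipartiteGraph.nD G)) (rfd : IsRFD G n s)
                     (M0 : Subset (PlaneBipartiteGraph.nD G)) (bottom : IsBottomMatching G M0)
                     (allowed : ∀ d → ∃[ M ] (PerfectMatching G M × d ∈ M))
                     (forcing : ForcingInfiniteFace G) where
  open Forcing G connected no-leaf n s rfd M0 bottom allowed forcing public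

  faceOf : ∀ d → SameFace G dInf d ⊎ ∃[ i ] SameFace G (s i) d
  faceOf d with sameFace? dInf d
  ... | yes p = inj₁ p
  ... | no ¬p = inj₂ (finite-face ¬p)

  abstract
    -- The stage at which the face left of the dart appears. The value n treats the infinite face as
    -- added last, so every finite face precedes it.
    rank : Dart → ℕ
    rank d = [ (λ _ → n) , (λ (i , _) → toℕ i) ] (faceOf d)

    rank-finite : ∀ {i d} → SameFace G (s i) d → rank d ≡ toℕ i
    rank-finite {i} {d} p with faceOf d
    ... | inj₁ q = contradiction q (sf-not-∞ p)
    ... | inj₂ (j , q) = cong toℕ (sf-unique q p)

    rank-∞ : ∀ {d} → SameFace G dInf d → rank d ≡ n
    rank-∞ {d} p with faceOf d
    ... | inj₁ _ = refl
    ... | inj₂ (j , q) = contradiction p (sf-not-∞ q)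

    rank-≤ : ∀ d → rank d ≤ n
    rank-≤ d with faceOf d
    ... | inj₁ _ = ℕₚ.≤-refl
    ... | inj₂ (i , _) = ℕₚ.<⇒≤ (toℕ<n i)

    rank-face : ∀ {d} {i : Fin n} → rank d ≡ toℕ i → SameFace G (s i) d
    rank-face {d} {i} e with faceOf d
    ... | inj₁ _ = contradiction (toℕ<n i) (ℕₚ.<-irrefl (sym e))
    ... | inj₂ (j , p) = subst (λ k → SameFace G (s k) d) (toℕ-injective e) p

    rank-injective : ∀ {d d'} → rank d ≡ rank d' → tail d ≡ tail d' → d ≡ d'
    rank-injective {d} {d'} e t with faceOf d | faceOf d'
    ... | inj₁ p | inj₁ q = proj₁ forcing _ _ p q t
    ... | inj₁ p | inj₂ (j , _) = contradiction (toℕ<n j) (ℕₚ.<-irrefl (sym e))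
    ... | inj₂ (i , _) | inj₁ q = contradiction (toℕ<n i) (ℕₚ.<-irrefl e)
    ... | inj₂ (i , p) | inj₂ (j , q) =
          facial p (subst (λ k → SameFace G (s k) d') (sym (toℕ-injective e)) q) t

    rank-InG : ∀ (i : Fin n) {d} → rank d ℕ.< toℕ i ⊎ rank (α d) ℕ.< toℕ i → InG G n s (toℕ i) d
    rank-InG i = [ below , (λ p → subst (InG G n s (toℕ i)) (α-invol _) (InG-α (below p))) ]
      where
      below : ∀ {d} → rank d ℕ.< toℕ i → InG G n s (toℕ i) d
      below {d} p with faceOf d
      ... | inj₁ _ = contradiction (toℕ<n i) (ℕₚ.<-asym p)
      ... | inj₂ (j , q) = j , p , inj₁ q

  rank-φ : ∀ d → rank (φ G d) ≡ rank d
  rank-φ d with faceOf d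
  ... | inj₁ p = trans (rank-∞ (sf-φ p)) (sym (rank-∞ p))
  ... | inj₂ (i , p) = trans (rank-finite (sf-φ p)) (sym (rank-finite p))

  rank-σ : ∀ d → rank (σ d) ≡ rank (α d)
  rank-σ d = trans (cong rank (sym (φ-α d))) (rank-φ (α d))

  InG-rank : ∀ (i : Fin n) {d} → InG G n s (toℕ i) d → rank d ℕ.< toℕ i ⊎ rank (α d) ℕ.< toℕ i
  InG-rank i (j , j<i , inj₁ p) = inj₁ (subst (ℕ._< toℕ i) (sym (rank-finite p)) j<i)
  InG-rank i (j , j<i , inj₂ p) = inj₂ (subst (ℕ._< toℕ i) (sym (rank-finite p)) j<i)

  old-rank : ∀ {i d} → SameFace G (s i) d → InG G n s (toℕ i) d → rank (α d) ℕ.< toℕ i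
  old-rank {i} p old = [ (λ q → contradiction q (ℕₚ.<-irrefl (rank-finite p))) , id ] (InG-rank i old)

  -- w leaves its tail along the end, in clockwise order, of a run of corners of rank < k.
  RunExit : ℕ → Dart → Set
  RunExit k w = rank w ℕ.< k × k ≤ rank (α w)

  -- Around every vertex the corners of rank below k form at most one interval of the rotation.
  SingleRun : ℕ → Set
  SingleRun k = ∀ {w w'} → tail w ≡ tail w' → RunExit k w → RunExit k w' → w ≡ w'

  -- A new corner at an old vertex is next to an old corner, so runs never multiply.
  no-second-run : ∀ (i : Fin n) → SingleRun (toℕ i) → ∀ {w w'} → tail w ≡ tail w' → rank w ≡ toℕ i →
                  toℕ i ℕ.< rank (α w) → rank w' ℕ.< toℕ i → toℕ i ℕ.< rank (α w') → ⊥
  no-second-run i single {w} {w'} t e above below' above' with φ-predecessor w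
  ... | x , refl , _ with InG? (toℕ i) x
  -- Both boundary edges of s_i at the vertex are new, so the vertex is new; but `w'` has an old
  -- corner there.
  ...   | no new = path-interior (ℕₚ.≤-trans (s≤s z≤n) below') on new
            (λ old → ℕₚ.<-asym above (old-rank (sf-φ on) old))
            (w' , rank-InG i (inj₁ below') , trans (sym t) (tail-φ x))
    where on = rank-face {x} {i} (trans (sym (rank-φ x)) e)
  -- The edge before `w` is old, so `α x` ends an old run and equals `w'`. The corner after `w'`
  -- then has rank exactly i, not more.
  ...   | yes old = ℕₚ.<-irrefl (trans (sym x-rank) (trans (cong rank (sym (α-invol x))) (cong (rank ∘ α) same))) above'
    where
    x-rank : rank x ≡ toℕ i
    x-rank = trans (sym (rank-φ x)) e
    same : α x ≡ w'
    same = single (trans (sym (tail-φ x)) t)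
      (old-rank (rank-face x-rank) old ,
       ℕₚ.≤-reflexive (sym (trans (cong rank (α-invol x)) x-rank)))
      (below' , ℕₚ.<⇒≤ above')

  single-run-step : ∀ (i : Fin n) → SingleRun (toℕ i) → SingleRun (suc (toℕ i))
  single-run-step i single {w} {w'} t (s≤s p , q) (s≤s p' , q') with ℕₚ.m≤n⇒m<n∨m≡n p | ℕₚ.m≤n⇒m<n∨m≡n p'
  ... | inj₁ l | inj₁ l' = single t (l , ℕₚ.<⇒≤ q) (l' , ℕₚ.<⇒≤ q')
  ... | inj₁ l | inj₂ e' = ⊥-elim (no-second-run i single (sym t) e' q' l q)
  ... | inj₂ e | inj₁ l' = ⊥-elim (no-second-run i single t e q l' q')
  ... | inj₂ e | inj₂ e' = rank-injective (trans e (sym e')) t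

  single-run : ∀ k → k ≤ n → SingleRun k
  single-run zero _ t (() , _)
  single-run (suc k) k<n = subst (SingleRun ∘ suc) (toℕ-fromℕ< k<n)
    (single-run-step (fromℕ< k<n) (subst SingleRun (sym (toℕ-fromℕ< k<n)) (single-run k (ℕₚ.<⇒≤ k<n))))

  -- Both boundary edges of s_i at this vertex are old, so the corner of s_i fills the single gap
  -- left by the old run and no later face fits in.
  local-maximum : ∀ {i x} → SameFace G (s i) x → rank (α x) ℕ.< toℕ i → rank (α (φ G x)) ℕ.< toℕ i →
                  ∀ {w} → tail w ≡ head G x → rank w ≤ toℕ i
  local-maximum {i} {x} p before after {w} t =
    let (k , e) = σ-trans (φ G x) w (trans (tail-φ x) (sym t)) in subst (λ z → rank z ≤ toℕ i) e (go k)
    where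
    tail-iter : ∀ k → tail (iter σ k (φ G x)) ≡ head G x
    tail-iter zero = tail-φ x
    tail-iter (suc k) = trans (σ-tail _) (tail-iter k)
    next : ∀ {z} → tail z ≡ head G x → rank z ≤ toℕ i → rank (α z) ≤ toℕ i
    next {z} tz le with ℕₚ.m≤n⇒m<n∨m≡n le | rank (α z) ℕ.≤? toℕ i
    ... | _ | yes ok = ok
    ... | inj₂ e | no ¬ok = contradiction (subst (λ y → rank (α y) ≤ toℕ i) (sym same) (ℕₚ.<⇒≤ after)) ¬ok
      where
      same : z ≡ φ G x
      same = rank-injective (trans e (sym (rank-finite (sf-φ p)))) (trans tz (sym (tail-φ x)))
    -- An exit from the old run towards a larger rank must be the exit `α x`, but the corner
    -- following `α x` is that of s_i.
    ... | inj₁ l | no ¬ok = contradiction (subst (λ y → rank y ≤ toℕ i)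
            (trans (sym (α-invol x)) (cong α same)) (ℕₚ.≤-reflexive (rank-finite p))) ¬ok
      where
      same : α x ≡ z
      same = single-run (toℕ i) (ℕₚ.<⇒≤ (toℕ<n i)) (sym tz)
        (before , ℕₚ.≤-reflexive (sym (trans (cong rank (α-invol x)) (rank-finite p))))
        (l , ℕₚ.<⇒≤ (ℕₚ.≰⇒> ¬ok))
    go : ∀ k → rank (iter σ k (φ G x)) ≤ toℕ i
    go zero = ℕₚ.≤-reflexive (rank-finite (sf-φ p))
    go (suc k) = subst (ℕ._≤ toℕ i) (sym (rank-σ _)) (next (tail-iter k) (go k))

  runStart? : ∀ i g → Dec (RunStart G n s i g)
  runStart? i g = sameFace? (s i) g ×-dec (InG? (toℕ i) g ×-dec ¬? (InG? (toℕ i) (φ G g)))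

  -- The edges in even position on the old part of the boundary of s_i.
  EvenOld : Fin n → Dart → Set
  EvenOld i d = SameFace G (s i) d × rank (α d) ℕ.< toℕ i ×
                ∃[ g ] (RunStart G n s i g × color (tail d) ≡ color (head G g))

  evenOld? : ∀ i d → Dec (EvenOld i d)
  evenOld? i d = sameFace? (s i) d ×-dec ((rank (α d) ℕ.<? toℕ i) ×-dec
                 any? λ g → runStart? i g ×-dec (color (tail d) ≟ᶜ color (head G g)))

  runStart-unique : ∀ {i g g'} → RunStart G n s i g → RunStart G n s i g' → g ≡ g'
  runStart-unique r r' = let 1≤i = InG-positive (proj₁ (proj₂ r)) in
    trans (lastOld-unique 1≤i r) (sym (lastOld-unique 1≤i r'))

  -- The last old edge has its head, not its tail, of the chosen colour. So an even edge is followed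
  -- by another old one.
  head-maximum : ∀ {i d} → EvenOld i d → ∀ {w} → tail w ≡ head G d → rank w ≤ toℕ i
  head-maximum {i} {d} (p , old , g , r , c) with InG? (toℕ i) (φ G d)
  ... | yes old' = local-maximum p old (old-rank (sf-φ p) old')
  ... | no new = contradiction (trans c (cong (color ∘ head G) (runStart-unique r (p , rank-InG i (inj₂ old) , new))))
                   (proper d)

  -- Since the new path is odd, the first old edge has a tail of the wrong colour. So an even edge
  -- is preceded by another old one.
  tail-maximum : ∀ {i d} → EvenOld i d → ∀ {w} → tail w ≡ tail d → rank w ≤ toℕ i
  tail-maximum {i} {d} (p , old , g , r , c) t with φ-predecessor d
  ... | x , refl , _ with InG? (toℕ i) x
  ...   | yes old' = local-maximum (sf-φ⁻ p) (old-rank (sf-φ⁻ p) old') old (trans t (tail-φ x))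
  ...   | no new = contradiction (trans (sym c) (cong color (tail-φ x)))
            (path-odd (InG-positive (proj₁ (proj₂ r))) r (sf-φ⁻ p , new , rank-InG i (inj₂ old)))

  EvenEdge : Dart → Set
  EvenEdge d = ∃[ i ] (EvenOld i d ⊎ EvenOld i (α d))

  evenEdge? : ∀ d → Dec (EvenEdge d)
  evenEdge? d = any? λ i → evenOld? i d ⊎-dec evenOld? i (α d)

  evenEdges : Subset nD
  evenEdges = fromDec evenEdge?

  edge-maximum : ∀ {d i} → EvenOld i d ⊎ EvenOld i (α d) → ∀ {w} → tail w ≡ tail d → rank w ≤ toℕ i
  edge-maximum (inj₁ e) t = tail-maximum e t
  edge-maximum {d} (inj₂ e) t = head-maximum e (trans t (cong tail (sym (α-invol d))))

  corner : ∀ {d i} → EvenOld i d ⊎ EvenOld i (α d) → ∃[ y ] (SameFace G (s i) y × tail y ≡ tail d)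
  corner {d} (inj₁ (p , _)) = d , p , refl
  corner {d} (inj₂ (p , _)) = σ d , sf-σ p , σ-tail d

  edge-index-≤ : ∀ {d d' i i'} → EvenOld i d ⊎ EvenOld i (α d) → EvenOld i' d' ⊎ EvenOld i' (α d') →
                 tail d ≡ tail d' → toℕ i' ≤ toℕ i
  edge-index-≤ e e' t = let (y , p , ty) = corner e' in
    subst (ℕ._≤ _) (rank-finite p) (edge-maximum e (trans ty (sym t)))

  -- The index is the largest rank at the common vertex, hence the same for both. On one face the
  -- colour of the vertex decides whether its even edge arrives there or leaves.
  evenEdge-unique : ∀ {d d'} → EvenEdge d → EvenEdge d' → tail d ≡ tail d' → d ≡ d'
  evenEdge-unique {d} {d'} (i , e) (i' , e') t
    with toℕ-injective (ℕₚ.≤-antisym (edge-index-≤ e' e (sym t)) (edge-index-≤ e e' t))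
  ... | refl = cases e e'
    where
    mixed : ∀ {d d'} → EvenOld i d → EvenOld i (α d') → tail d ≢ tail d'
    mixed {d} {d'} (_ , _ , _ , r , c) (_ , _ , _ , r' , c') t =
      proper d' (trans (cong color (sym t)) (trans c (trans (cong (color ∘ head G) (runStart-unique r r')) (sym c'))))
    cases : EvenOld i d ⊎ EvenOld i (α d) → EvenOld i d' ⊎ EvenOld i (α d') → d ≡ d'
    cases (inj₁ (p , _)) (inj₁ (p' , _)) = facial p p' t
    cases (inj₂ (p , _)) (inj₂ (p' , _)) =
      σ-inj _ _ (facial (sf-σ p) (sf-σ p') (trans (σ-tail d) (trans t (sym (σ-tail d')))))
    cases (inj₁ x) (inj₂ x') = contradiction t (mixed x x')
    cases (inj₂ x) (inj₁ x') = contradiction (sym t) (mixed x' x)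

  highest : ∀ v → ∃[ y ] (tail y ≡ v × (∀ {w} → tail w ≡ v → rank w ≤ rank y))
  -- Each improvement raises the rank by at least 1 and ranks are at most n, so n rounds suffice.
  highest v = let (d , t) = proj₁ connected v in go n d t (ℕₚ.m≤m+n n (rank d))
    where
    go : ∀ fuel d → tail d ≡ v → n ≤ fuel ℕ.+ rank d →
         ∃[ y ] (tail y ≡ v × (∀ {w} → tail w ≡ v → rank w ≤ rank y))
    go zero d t top = d , t , λ {w} _ → ℕₚ.≤-trans (rank-≤ w) top
    go (suc fuel) d t top with any? (λ w → (tail w ≟ v) ×-dec (rank d ℕ.<? rank w))
    ... | no none = d , t , λ {w} tw → ℕₚ.≮⇒≥ λ l → none (w , tw , l)
    ... | yes (w , tw , l) = go fuel w tw
            (ℕₚ.≤-trans top (subst (ℕ._≤ fuel ℕ.+ rank w) (ℕₚ.+-suc fuel (rank d)) (ℕₚ.+-monoʳ-≤ fuel l)))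

  -- The face of largest rank at the vertex is finite and has only one corner there. Its two edges
  -- at this corner border faces of smaller rank, so both are old, and the colour selects one of
  -- them.
  evenEdge-exists : ∀ v → ¬ OnPeriphery G v → ∃[ d ] (tail d ≡ v × EvenEdge d)
  evenEdge-exists v off with highest v
  ... | y , t , top with faceOf y
  ...   | inj₁ p = contradiction (y , p , t) off
  ...   | inj₂ (i , p) with φ-predecessor y
  ...     | x , refl , _ = choose (color (tail (φ G x)) ≟ᶜ color (head G g))
    where
    on = sf-φ⁻ p
    below : ∀ {w} → tail w ≡ v → w ≢ φ G x → rank w ℕ.< toℕ i
    below {w} tw ne = ℕₚ.≤∧≢⇒< (subst (rank w ≤_) (rank-finite p) (top tw))
      λ e → ne (rank-injective (trans e (sym (rank-finite p))) (trans tw (sym t)))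
    after : rank (α (φ G x)) ℕ.< toℕ i
    after = subst (ℕ._< toℕ i) (rank-σ (φ G x)) (below (trans (σ-tail _) t) (no-leaf (φ G x)))
    before : rank (α x) ℕ.< toℕ i
    before = below (trans (sym (tail-φ x)) t) (no-leaf (α x) ∘ sym)
    1≤i = ℕₚ.≤-trans (s≤s z≤n) before
    g = lastOld 1≤i
    choose : Dec (color (tail (φ G x)) ≡ color (head G g)) → ∃[ d ] (tail d ≡ v × EvenEdge d)
    choose (yes c) = φ G x , t , i , inj₁ (p , after , g , lastOld-run 1≤i , c)
    choose (no c) = α x , trans (sym (tail-φ x)) t , i , inj₂
      (subst (EvenOld i) (sym (α-invol x)) (on , before , g , lastOld-run 1≤i ,
        opposite-unique (λ e → proper x (trans (sym e) (cong color (tail-φ x)))) c))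

  evenEdges-inner : InnerPerfectMatching G evenEdges
  evenEdges-inner =
    (λ d m → ∈-fromDec⁺ evenEdge? (flip (∈-fromDec⁻ evenEdge? m))) ,
    -- The infinite face has rank n, while the ranks around an end of an even edge are at most its
    -- index.
    (λ d m (p , on , t) → let (i , e) = ∈-fromDec⁻ evenEdge? m in
      ℕₚ.<⇒≱ (toℕ<n i) (subst (ℕ._≤ toℕ i) (rank-∞ on) (edge-maximum e t))) ,
    λ v off → let (d , t , e) = evenEdge-exists v off in
      d , t , ∈-fromDec⁺ evenEdge? e ,
      λ d' t' m → evenEdge-unique (∈-fromDec⁻ evenEdge? m) e (trans t' (sym t))
    where
    flip : ∀ {d} → EvenEdge d → EvenEdge (α d)
    flip {d} (i , inj₁ e) = i , inj₂ (subst (EvenOld i) (sym (α-invol d)) e)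
    flip (i , inj₂ e) = i , inj₁ e

  module _ {i d} (p : SameFace G (s i) d) (old : rank (α d) ℕ.< toℕ i) where

    -- Forcing leaves one perfect matching of the interior, so the even edges are the inner part of
    -- `M0`.
    old-M0⁺ : ∀ {g} → RunStart G n s i g → color (tail d) ≡ color (head G g) → d ∈ M0
    old-M0⁺ r c = proj₁ (∈-fromDec⁻ (inner? M0) (subst (d ∈_) (inner-unique evenEdges-inner inner-M0)
      (∈-fromDec⁺ evenEdge? (i , inj₁ (p , old , _ , r , c)))))

    old-M0⁻ : ∀ {g} → RunStart G n s i g → d ∈ M0 → color (tail d) ≡ color (head G g)
    old-M0⁻ {g} r m0 = same-index (∈-fromDec⁻ evenEdge? (subst (d ∈_) (inner-unique inner-M0 evenEdges-inner)
      (∈-fromDec⁺ (inner? M0) (m0 , off))))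
      where
      off : ¬ OnPeriphery G (tail d)
      off on with periphery-matched on m0
      ... | inj₁ q = sf-not-∞ p q
      ... | inj₂ q = ℕₚ.<-asym old (subst (toℕ i ℕ.<_) (sym (rank-∞ q)) (toℕ<n i))
      same-index : EvenEdge d → color (tail d) ≡ color (head G g)
      same-index (j , inj₁ (q , _ , _ , r' , c)) with sf-unique q p
      ... | refl = trans c (cong (color ∘ head G) (runStart-unique r' r))
      -- An even edge lies on the later of its two faces; for `d` that face is s_i, on its left, not
      -- the one on its right.
      same-index (j , inj₂ (q , old' , _)) = contradiction
        (subst₂ ℕ._<_ (trans (cong rank (α-invol d)) (rank-finite p)) (sym (rank-finite q)) old')
        (ℕₚ.<-asym old)

-- Binary words of the algorithm as local constraints

sum-pair-≤ : ∀ {N} (g : Fin N → ℤ) → (∀ d → 0ℤ ℤ.≤ g d) → ∀ {a b} → a ≢ b → g a + g b ℤ.≤ sum g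
sum-pair-≤ {suc N} g p {a} {b} a≢b =
  subst (g a + g b ℤ.≤_) (sym (sum-remove {i = a} g))
    (ℤₚ.+-monoʳ-≤ (g a) (subst (ℤ._≤ sum (VF.removeAt g a)) (cong g (Finₚ.punchIn-punchOut a≢b))
      (sum-member (VF.removeAt g a) (λ d → p _) (Fin.punchOut a≢b))))

lookup-∷ʳ-old : ∀ {A : Set} {k m} (y : Vec A k) b (q : m ℕ.< k) (q' : m ℕ.< suc k) →
                lookup (y ∷ʳ b) (fromℕ< q') ≡ lookup y (fromℕ< q)
lookup-∷ʳ-old {m = zero}  (_ ∷ _) b _ _ = refl
lookup-∷ʳ-old {m = suc m} (_ ∷ y) b (s≤s q) (s≤s q') = lookup-∷ʳ-old y b q q'

lookup-∷ʳ-new : ∀ {A : Set} {k} (y : Vec A k) b (q : k ℕ.< suc k) → lookup (y ∷ʳ b) (fromℕ< q) ≡ b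
lookup-∷ʳ-new []      b _ = refl
lookup-∷ʳ-new (_ ∷ y) b (s≤s q) = lookup-∷ʳ-new y b q

module Language (G : PlaneBipartiteGraph) (n : ℕ) (s : Fin n → Fin (PlaneBipartiteGraph.nD G)) where

  WB : Fin n → Set
  WB = WhiteBlack G n s

  -- One step of the algorithm as a condition on the digit `b` of s_i and the digit `c` of an
  -- earlier adjacent face. The branches that append a digit freely are those where both
  -- implications are vacuous.
  Admissible : (i j : Fin n) → Bool → Bool → Set
  Admissible i j b c = (WB i → b ≡ true → c ≡ true) × (¬ WB i → b ≡ false → c ≡ false)

  Respects : (Fin n → Bool) → Set
  Respects x = ∀ i j → toℕ j ℕ.< toℕ i → Adj G n s j i → Admissible i j (x i) (x j)

  PrefixRespects : ∀ {k} → Vec Bool k → Set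
  PrefixRespects {k} y = ∀ i j (p : toℕ i ℕ.< k) (q : toℕ j ℕ.< k) → toℕ j ℕ.< toℕ i → Adj G n s j i →
    Admissible i j (lookup y (fromℕ< p)) (lookup y (fromℕ< q))

  extend : ∀ i (y : Vec Bool (toℕ i)) b → PrefixRespects y →
           (∀ j (q : toℕ j ℕ.< toℕ i) → Adj G n s j i → Admissible i j b (lookup y (fromℕ< q))) →
           PrefixRespects (y ∷ʳ b)
  extend i y b old new i' j (s≤s p) q j<i' adj with ℕₚ.m≤n⇒m<n∨m≡n p
  ... | inj₁ l = subst₂ (Admissible i' j) (sym (lookup-∷ʳ-old y b l (s≤s p)))
                   (sym (lookup-∷ʳ-old y b (ℕₚ.<-trans j<i' l) q)) (old i' j l (ℕₚ.<-trans j<i' l) j<i' adj)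
  ... | inj₂ e with toℕ-injective e
  ...   | refl = subst₂ (Admissible i j) (sym (lookup-∷ʳ-new y b (s≤s p)))
                   (sym (lookup-∷ʳ-old y b j<i' q)) (new j j<i' adj)

  InL-prefix : ∀ {k y} → InL G n s k y → PrefixRespects y
  InL-prefix (base b) i j (s≤s i≤0) q j<i adj = contradiction (ℕₚ.≤-trans j<i i≤0) λ ()
  InL-prefix (wb0 i {y} l wb) =
    extend i y false (InL-prefix l) λ j q adj → (λ _ ()) , λ ¬wb → contradiction wb ¬wb
  InL-prefix (wb1 i {y} l wb c) =
    extend i y true (InL-prefix l) λ j q adj → (λ _ _ → c j q adj) , λ _ ()
  InL-prefix (bw1 i {y} l ¬wb) =
    extend i y true (InL-prefix l) λ j q adj → (λ wb → contradiction wb ¬wb) , λ _ ()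
  InL-prefix (bw0 i {y} l ¬wb c) =
    extend i y false (InL-prefix l) λ j q adj → (λ _ ()) , λ _ _ → c j q adj

  InL-respects : ∀ {y} → InL G n s n y → Respects (lookup y)
  InL-respects {y} l i j j<i adj =
    subst₂ (λ a b → Admissible i j (lookup y a) (lookup y b)) (fromℕ<-toℕ i (toℕ<n i)) (fromℕ<-toℕ j (toℕ<n j))
      (InL-prefix l i j (toℕ<n i) (toℕ<n j) j<i adj)

  module _ (wb? : ∀ i → Dec (WB i)) {x : Fin n → Bool} (resp : Respects x) where

    Prefix : ∀ {k} → Vec Bool k → Set
    Prefix {k} y = ∀ j (q : toℕ j ℕ.< k) → lookup y (fromℕ< q) ≡ x j

    prefix-step : ∀ (i : Fin n) → (∀ (y : Vec Bool (toℕ i)) → Prefix y → InL G n s (toℕ i) y) →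
                  ∀ (y : Vec Bool (suc (toℕ i))) → Prefix y → InL G n s (suc (toℕ i)) y
    prefix-step i shorter y pre with Vec.initLast y
    ... | y' , b , refl = by-colour b (wb? i) x-i
      where
      pre' : Prefix y'
      pre' j q = trans (sym (lookup-∷ʳ-old y' b q (ℕₚ.m<n⇒m<1+n q))) (pre j (ℕₚ.m<n⇒m<1+n q))
      l = shorter y' pre'
      x-i : x i ≡ b
      x-i = trans (sym (pre i (ℕₚ.n<1+n _))) (lookup-∷ʳ-new y' b (ℕₚ.n<1+n _))
      by-colour : ∀ b → Dec (WB i) → x i ≡ b → InL G n s (suc (toℕ i)) (y' ∷ʳ b)
      by-colour false (yes wb) e = wb0 i l wb
      by-colour true (yes wb) e = wb1 i l wb λ j q adj → trans (pre' j q) (proj₁ (resp i j q adj) wb e)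
      by-colour true (no ¬wb) e = bw1 i l ¬wb
      by-colour false (no ¬wb) e = bw0 i l ¬wb λ j q adj → trans (pre' j q) (proj₂ (resp i j q adj) ¬wb e)

    prefix-InL : ∀ k → suc k ≤ n → ∀ (y : Vec Bool (suc k)) → Prefix y → InL G n s (suc k) y
    prefix-InL zero _ (b ∷ []) _ = base b
    prefix-InL (suc k) k<n =
      subst Claim (toℕ-fromℕ< k<n) (prefix-step (fromℕ< k<n)
        (subst Claim' (sym (toℕ-fromℕ< k<n)) (prefix-InL k (ℕₚ.<⇒≤ k<n))))
      where
      Claim' Claim : ℕ → Set
      Claim' m = ∀ (y : Vec Bool m) → Prefix y → InL G n s m y
      Claim m = Claim' (suc m)

    respects-InL : 1 ≤ n → InL G n s n (tabulate x)
    respects-InL 1≤n = full n 1≤n ℕₚ.≤-refl (tabulate x)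
      λ j q → trans (lookup∘tabulate x (fromℕ< q)) (cong x (fromℕ<-toℕ j q))
      where
      full : ∀ k → 1 ≤ k → k ≤ n → (y : Vec Bool k) → Prefix y → InL G n s k y
      full (suc k) _ = prefix-InL k

-- The edge at a leaf lies in every perfect matching, which excludes all other edges at its far end.
-- The graph is then a single edge with a single face, yet it must have a finite and an infinite
-- one.
elementary-no-leaf : ∀ {G n} {s : Fin n → Fin (PlaneBipartiteGraph.nD G)} → Elementary G → 1 ≤ n → IsRFD G n s →
                     ∀ d → PlaneBipartiteGraph.σ G d ≢ d
elementary-no-leaf {G} {n} {s} (connected , allowed) 1≤n rfd y leaf =
  proj₁ (proj₂ rfd) first (sf-trans (sf-sym (all-same-face dInf)) (all-same-face (s first)))
  where
  open Map G
  first = fromℕ< 1≤n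
  stays : ∀ k → iter σ k y ≡ y
  stays zero = refl
  stays (suc k) = trans (cong σ (stays k)) leaf
  leaf-matched : ∀ {M} → PerfectMatching G M → y ∈ M
  leaf-matched {M} P with σ-trans y (mate P (tail y)) (sym (tail-mate P (tail y)))
  ... | k , e = subst (_∈ M) (trans (sym e) (stays k)) (mate-∈ P (tail y))
  other-leaf : σ (α y) ≡ α y
  other-leaf with allowed (σ (α y))
  ... | M , P , m = matching-unique P m (matching-α P (leaf-matched P)) (σ-tail (α y))
  only-edge : ∀ {d} → d ≡ y ⊎ d ≡ α y → ∀ {d'} → Star (ConnStep G) d d' → d' ≡ y ⊎ d' ≡ α y
  only-edge e ε = e
  only-edge (inj₁ refl) (rev _ ◅ st) = only-edge (inj₂ refl) st
  only-edge (inj₂ refl) (rev _ ◅ st) = only-edge (inj₁ (α-invol y)) st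
  only-edge (inj₁ refl) (rot _ ◅ st) = only-edge (inj₁ leaf) st
  only-edge (inj₂ refl) (rot _ ◅ st) = only-edge (inj₂ other-leaf) st
  all-same-face : ∀ d → SameFace G y d
  all-same-face d with only-edge (inj₁ refl) (proj₂ connected y d)
  ... | inj₁ refl = sf-refl
  ... | inj₂ refl = 1 , other-leaf

-- Matchings and admissible words

module Coding (G : PlaneBipartiteGraph) (connected : Connected G) (no-leaf : ∀ d → PlaneBipartiteGraph.σ G d ≢ d)
              (n : ℕ) (s : Fin n → Fin (PlaneBipartiteGraph.nD G)) (rfd : IsRFD G n s)
              (M0 : Subset (PlaneBipartiteGraph.nD G)) (bottom : IsBottomMatching G M0)
              (allowed : ∀ d → ∃[ M ] (PerfectMatching G M × d ∈ M))
              (forcing : ForcingInfiniteFace G) where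
  open InnerMatching G connected no-leaf n s rfd M0 bottom allowed forcing
  open Language G n s

  wb? : ∀ i → Dec (WB i)
  wb? i = any? λ g → runStart? i g ×-dec (color (head G g) ≟ᶜ black)

  -- The sign of the flow of any matching on a dart is dictated by M0.
  Rising Falling : Dart → Set
  Rising d = (color (tail d) ≡ white × d ∉ M0) ⊎ (color (tail d) ≡ black × d ∈ M0)
  Falling d = (color (tail d) ≡ white × d ∈ M0) ⊎ (color (tail d) ≡ black × d ∉ M0)

  head-black : ∀ {d} → color (tail d) ≡ white → color (tail (α d)) ≡ black
  head-black {d} e = opposite-unique (proper d) λ e' → contradiction (trans (sym e) e') λ ()

  head-white : ∀ {d} → color (tail d) ≡ black → color (tail (α d)) ≡ white
  head-white {d} e = opposite-unique (proper d) λ e' → contradiction (trans (sym e) e') λ ()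

  rising-α : ∀ {d} → Rising d → Falling (α d)
  rising-α = [ (λ (c , m) → inj₂ (head-black c , m ∘ matching-α⁻ P0)) ,
               (λ (c , m) → inj₁ (head-white c , matching-α P0 m)) ]

  falling-α : ∀ {d} → Falling d → Rising (α d)
  falling-α = [ (λ (c , m) → inj₂ (head-black c , matching-α P0 m)) ,
                (λ (c , m) → inj₁ (head-white c , m ∘ matching-α⁻ P0)) ]

  module _ {M : Subset nD} where

    -- An edge outside `M0` can only be gained and one inside only lost; with the colour of the tail
    -- this fixes the sign.
    rising-flow : ∀ {d} → Rising d → 0ℤ ℤ.≤ flow M M0 d
    rising-flow {d} r with symDiff? M M0 d
    ... | no no-sd = ℤₚ.≤-reflexive (sym (flow-zero no-sd))
    rising-flow (inj₁ (c , m0)) | yes (inj₁ (m , _)) =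
      subst (0ℤ ℤ.≤_) (sym (trans (flow-gain m m0) (cong (λ k → sgn k 1ℤ) c))) (+≤+ z≤n)
    rising-flow (inj₁ (c , m0)) | yes (inj₂ (_ , m)) = contradiction m m0
    rising-flow (inj₂ (c , m0)) | yes (inj₁ (_ , m)) = contradiction m0 m
    rising-flow (inj₂ (c , m0)) | yes (inj₂ (m , _)) =
      subst (0ℤ ℤ.≤_) (sym (trans (flow-loss m m0) (cong (λ k → sgn k -1ℤ) c))) (+≤+ z≤n)

  rising-height : ∀ {M} (P : PerfectMatching G M) {d} → Rising d → ht (height P) d ℤ.≤ ht (height P) (α d)
  rising-height P {d} r = subst₂ ℤ._≤_ (ℤₚ.+-identityʳ _) (sym (ht-α (height P) d))
    (ℤₚ.+-monoʳ-≤ (ht (height P) d) (rising-flow r))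

  falling-height : ∀ {M} (P : PerfectMatching G M) {d} → Falling d → ht (height P) (α d) ℤ.≤ ht (height P) d
  falling-height P {d} r = subst (ht (height P) (α d) ℤ.≤_) (cong (ht (height P)) (α-invol d))
    (rising-height P (falling-α r))

  periphery-rising : ∀ {d} → SameFace G dInf d → Rising d
  periphery-rising {d} p with color (tail d) in eq
  ... | white = inj₁ (refl , periphery-white-∉ p eq)
  ... | black = inj₂ (refl , periphery-black p eq)

  module _ {i d} (p : SameFace G (s i) d) (old : rank (α d) ℕ.< toℕ i) where

    -- The old run on s_i ends at a black vertex, so `M0` contains exactly the old darts with black
    -- tail. Crossing from s_i to an earlier face never lowers the height, whence digit 1 demands
    -- digits 1.
    wb-rising : WB i → Rising d
    wb-rising (g , r , b) with color (tail d) in eq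
    ... | black = inj₂ (refl , old-M0⁺ p old r (trans eq (sym b)))
    ... | white = inj₁ (refl , λ m0 → contradiction (trans (sym eq) (trans (old-M0⁻ p old r m0) b)) λ ())

    -- Here the run ends at a white vertex and the alternation has the other phase, so digit 0
    -- demands digits 0.
    bw-falling : ¬ WB i → Falling d
    bw-falling ¬wb with color (head G (lastOld 1≤i)) in eqg
      where 1≤i = ℕₚ.≤-trans (s≤s z≤n) old
    ... | black = contradiction (_ , lastOld-run _ , eqg) ¬wb
    ... | white with color (tail d) in eq
    ...   | white = inj₁ (refl , old-M0⁺ p old (lastOld-run _) (trans eq (sym eqg)))
    ...   | black = inj₂ (refl , λ m0 → contradiction (trans (sym eq) (trans (old-M0⁻ p old (lastOld-run _) m0) eqg)) λ ())

  module _ {M} (P : PerfectMatching G M) where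

    code : Fin n → Bool
    code i = ⌊ ht (height P) (s i) ℤ.≟ 1ℤ ⌋

    code-height : ∀ i → ht (height P) (s i) ≡ indicator (code i)
    code-height i with ht (height P) (s i) ℤ.≟ 1ℤ | height-01 P (s i)
    ... | yes e | _ = e
    ... | no ne | inj₁ e = e
    ... | no ne | inj₂ e = contradiction e ne

    indicator-true : ∀ {b c} → indicator b ℤ.≤ indicator c → b ≡ true → c ≡ true
    indicator-true {true} {true} _ _ = refl
    indicator-true {true} {false} (+≤+ ()) _

    indicator-false : ∀ {b c} → indicator c ℤ.≤ indicator b → b ≡ false → c ≡ false
    indicator-false {false} {false} _ _ = refl
    indicator-false {false} {true} (+≤+ ()) _

    code-respects : Respects code
    code-respects i j j<i (d , p , q) =
      (λ wb → indicator-true (subst₂ ℤ._≤_ at-i at-j (rising-height P (wb-rising q old wb)))) ,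
      λ ¬wb → indicator-false (subst₂ ℤ._≤_ at-j at-i (falling-height P (bw-falling q old ¬wb)))
      where
      back : SameFace G (s j) (α (α d))
      back = subst (SameFace G (s j)) (sym (α-invol d)) p
      old : rank (α (α d)) ℕ.< toℕ i
      old = subst (ℕ._< toℕ i) (sym (rank-finite back)) j<i
      at-i : ht (height P) (α d) ≡ indicator (code i)
      at-i = trans (ht-face (height P) q) (code-height i)
      at-j : ht (height P) (α (α d)) ≡ indicator (code j)
      at-j = trans (ht-face (height P) back) (code-height j)

    code-phi : PhiIs G n s M0 M (tabulate code)
    code-phi i = phi-height P (s i) (lookup (tabulate code) i)
      (trans (code-height i) (cong indicator (sym (lookup∘tabulate code i))))

  -- The digits give the heights of all faces, their differences give the flow, and the flow
  -- relative to `M0` gives the matching.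
  phi-injective : ∀ {M M' x} → PerfectMatching G M → PerfectMatching G M' →
                  PhiIs G n s M0 M x → PhiIs G n s M0 M' x → M ≡ M'
  phi-injective {M} {M'} {x} P P' φ φ' =
    ⊆-antisym (λ {d} → ind-injective (same-ind d)) (λ {d} → ind-injective (sym (same-ind d)))
    where
    same-height : ∀ d → ht (height P) d ≡ ht (height P') d
    same-height d with faceOf d
    ... | inj₁ p = trans (ht-∞-face (height P) p) (sym (ht-∞-face (height P') p))
    ... | inj₂ (i , p) = trans (ht-face (height P) p) (trans (height-phi P (s i) (lookup x i) (φ i))
            (sym (trans (ht-face (height P') p) (height-phi P' (s i) (lookup x i) (φ' i)))))
    cancel : ∀ {x y z w} → x ≡ y → x + z ≡ y + w → z ≡ w
    cancel {x} {_} {z} {w} refl e = trans (isolate x z) (trans (cong (_+ - x) e) (sym (isolate x w)))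
      where
      isolate : ∀ x y → y ≡ x + y + - x
      isolate = solve-∀
    same-flow : ∀ d → flow M M0 d ≡ flow M' M0 d
    same-flow d = cancel (same-height d)
      (trans (sym (ht-α (height P) d)) (trans (same-height (α d)) (ht-α (height P') d)))
    sgn-injective : ∀ c {y z} → sgn c y ≡ sgn c z → y ≡ z
    sgn-injective white e = e
    sgn-injective black e = ℤₚ.neg-injective e
    same-ind : ∀ d → ind M d ≡ ind M' d
    same-ind d = cancel {x = - ind M0 d} refl
      (trans (ℤₚ.+-comm (- ind M0 d) (ind M d)) (trans (sgn-injective (color (tail d)) (same-flow d))
        (ℤₚ.+-comm (ind M' d) (- ind M0 d))))

  module Decode {x : Fin n → Bool} (resp : Respects x) where

    abstract
      level : Dart → Bool
      level d = [ (λ _ → false) , (λ (i , _) → x i) ] (faceOf d)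

      level-finite : ∀ {i d} → SameFace G (s i) d → level d ≡ x i
      level-finite {i} {d} p with faceOf d
      ... | inj₁ q = contradiction q (sf-not-∞ p)
      ... | inj₂ (j , q) = cong x (sf-unique q p)

      level-∞ : ∀ {d} → SameFace G dInf d → level d ≡ false
      level-∞ {d} p with faceOf d
      ... | inj₁ _ = refl
      ... | inj₂ (j , q) = contradiction p (sf-not-∞ q)

    level-φ : ∀ d → level (φ G d) ≡ level d
    level-φ d with faceOf d
    ... | inj₁ p = trans (level-∞ (sf-φ p)) (sym (level-∞ p))
    ... | inj₂ (i , p) = trans (level-finite (sf-φ p)) (sym (level-finite p))

    -- The levels may change across the edge only in the direction in which switching it in `M0`
    -- sends flow.
    Oriented : Dart → Set
    Oriented d = (Rising d × (level d ≡ true → level (α d) ≡ true)) ⊎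
                 (Falling d × (level (α d) ≡ true → level d ≡ true))

    oriented-α : ∀ {d} → Oriented (α d) → Oriented d
    oriented-α {d} = subst Oriented (α-invol d) ∘ Sum.swap ∘
      Sum.map (λ (r , f) → rising-α r , f ∘ trans (cong level (sym (α-invol (α d)))))
              (λ (r , f) → falling-α r , λ e → trans (cong level (α-invol (α d))) (f e))

    oriented-new : ∀ {i j d} → SameFace G (s i) d → SameFace G (s j) (α d) → toℕ j ℕ.< toℕ i → Oriented d
    oriented-new {i} {j} {d} p q j<i with wb? i
    ... | yes wb = inj₁ (wb-rising p old wb , λ e → trans (level-finite q)
            (proj₁ adm wb (trans (sym (level-finite p)) e)))
      where
      old = subst (ℕ._< toℕ i) (sym (rank-finite q)) j<i
      adm = resp i j j<i (α d , q , subst (SameFace G (s i)) (sym (α-invol d)) p)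
    ... | no ¬wb = inj₂ (bw-falling p old ¬wb , λ e → trans (level-finite p)
            (not-false (λ f → contradiction (trans (sym e) (trans (level-finite q) (proj₂ adm ¬wb f))) λ ())))
      where
      old = subst (ℕ._< toℕ i) (sym (rank-finite q)) j<i
      adm = resp i j j<i (α d , q , subst (SameFace G (s i)) (sym (α-invol d)) p)
      not-false : ∀ {b} → ¬ (b ≡ false) → b ≡ true
      not-false {true} _ = refl
      not-false {false} ne = contradiction refl ne

    oriented-∞ : ∀ {d} → SameFace G dInf d → Oriented d
    oriented-∞ p = inj₁ (periphery-rising p , λ e → contradiction (trans (sym e) (level-∞ p)) λ ())

    -- The later of the two faces at an edge imposes the condition, by its step of the algorithm. At
    -- the infinite face it holds because the level there is 0.
    oriented : ∀ d → Oriented d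
    oriented d with faceOf d | faceOf (α d)
    ... | inj₁ p | _ = oriented-∞ p
    ... | inj₂ _ | inj₁ q = oriented-α (oriented-∞ q)
    ... | inj₂ (i , p) | inj₂ (j , q) with ℕₚ.<-cmp (toℕ i) (toℕ j)
    ...   | tri> _ _ j<i = oriented-new p q j<i
    ...   | tri< i<j _ _ = oriented-α (oriented-new q (subst (SameFace G (s i)) (sym (α-invol d)) p) i<j)
    ...   | tri≈ _ e _ = contradiction q (two-sided (subst (λ k → SameFace G (s k) d) (toℕ-injective e) p))

    differ? : ∀ d → Dec (level d ≢ level (α d))
    differ? d = ¬? (level d Bool.≟ level (α d))

    B : Subset nD
    B = fromDec differ?

    B-α : ∀ {d} → d ∈ B → α d ∈ B
    B-α {d} b = ∈-fromDec⁺ differ? λ e → ∈-fromDec⁻ differ? b (trans (sym (cong level (α-invol d))) (sym e))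

    M : Subset nD
    M = M0 ⊖ B

    height-of : Dart → ℤ
    height-of d = indicator (level d)

    -- Each edge between different levels is switched, and its orientation makes the resulting unit
    -- of flow point from level 0 to level 1.
    flow-M : ∀ d → flow M M0 d ≡ height-of (α d) + - height-of d
    flow-M d with level d Bool.≟ level (α d)
    ... | yes e = trans (flow-agree (⊖-outside d∉) λ m → ⊖-keep m d∉)
            (sym (trans (cong (λ b → height-of (α d) + - indicator b) e) (ℤₚ.+-inverseʳ (height-of (α d)))))
      where
      d∉ : d ∉ B
      d∉ b = ∈-fromDec⁻ differ? b e
    ... | no ne = by-direction (oriented d)
      where
      d∈ : d ∈ B
      d∈ = ∈-fromDec⁺ differ? ne
      lost : d ∈ M0 → d ∉ M
      lost m0 m = ⊖-inside d∈ m m0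
      up : ∀ {b c} → b ≢ c → (b ≡ true → c ≡ true) → 1ℤ ≡ indicator c + - indicator b
      up {false} {false} ne _ = contradiction refl ne
      up {false} {true} _ _ = refl
      up {true} ne f = contradiction (sym (f refl)) ne
      down : ∀ {b c} → b ≢ c → (c ≡ true → b ≡ true) → -1ℤ ≡ indicator c + - indicator b
      down {true} {true} ne _ = contradiction refl ne
      down {true} {false} _ _ = refl
      down {false} {false} ne _ = contradiction refl ne
      down {false} {true} ne f = contradiction (f refl) ne
      by-direction : Oriented d → flow M M0 d ≡ height-of (α d) + - height-of d
      by-direction (inj₁ (inj₁ (c , m0) , f)) =
        trans (flow-gain (⊖-add m0 d∈) m0) (trans (cong (λ k → sgn k 1ℤ) c) (up ne f))
      by-direction (inj₁ (inj₂ (c , m0) , f)) =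
        trans (flow-loss (lost m0) m0) (trans (cong (λ k → sgn k -1ℤ) c) (up ne f))
      by-direction (inj₂ (inj₁ (c , m0) , f)) =
        trans (flow-loss (lost m0) m0) (trans (cong (λ k → sgn k -1ℤ) c) (down ne f))
      by-direction (inj₂ (inj₂ (c , m0) , f)) =
        trans (flow-gain (⊖-add m0 d∈) m0) (trans (cong (λ k → sgn k 1ℤ) c) (down ne f))

    -- `M` and `M0` differ by a gradient, which sums to zero around a vertex. This counts the edges
    -- of `M` there without describing the switched set.
    degree-one : ∀ v → Σᵥ v (ind M) ≡ 1ℤ
    degree-one v =
      trans (Σᵥ-cong (ind M) (λ d → (u (α d) + - u d) + ind M0 d) split)
        (trans (Σᵥ-+ v (λ d → u (α d) + - u d) (ind M0))
          (cong₂ _+_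
            (conserved (gradient-flow u λ d → cong (sgn (color v) ∘ indicator) (level-φ d)) v)
            (trans (Σᵥ-single (ind M0) (mate P0 v) (tail-mate P0 v)
                     λ d t ne → ind-∉ λ m → ne (mate-unique P0 t m))
                   (ind-∈ (mate-∈ P0 v)))))
      where
      u : Dart → ℤ
      u d = sgn (color v) (height-of d)
      twice : ∀ c y z → sgn c (sgn c (y + - z)) + z ≡ y
      twice white y z = cancel y z
        where
        cancel : ∀ y z → y + - z + z ≡ y
        cancel = solve-∀
      twice black y z = cancel y z
        where
        cancel : ∀ y z → - (- (y + - z)) + z ≡ y
        cancel = solve-∀
      sgn-diff : ∀ c y z → sgn c (y + - z) ≡ sgn c y + - sgn c z
      sgn-diff white y z = refl
      sgn-diff black y z = ℤₚ.neg-distrib-+ y (- z)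
      split : ∀ d → tail d ≡ v → ind M d ≡ (u (α d) + - u d) + ind M0 d
      split d refl = sym (trans (cong (_+ ind M0 d) (trans (sym (sgn-diff (color v) (height-of (α d)) (height-of d)))
        (cong (sgn (color v)) (sym (flow-M d))))) (twice (color v) (ind M d) (ind M0 d)))

    matching : PerfectMatching G M
    matching = (λ d → closed) , λ v → at-vertex v
      where
      closed : ∀ {d} → d ∈ M → α d ∈ M
      closed {d} m with ⊖-split m
      ... | inj₁ (m0 , b) = ⊖-keep (matching-α P0 m0) λ b' → b (subst (_∈ B) (α-invol d) (B-α b'))
      ... | inj₂ (m0 , b) = ⊖-add (m0 ∘ matching-α⁻ P0) (B-α b)
      nonneg : ∀ v d → 0ℤ ℤ.≤ atVertex v (ind M) d
      nonneg v d with tail d ≟ v | d ∈? M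
      ... | yes _ | yes _ = +≤+ z≤n
      ... | yes _ | no _ = +≤+ z≤n
      ... | no _ | _ = +≤+ z≤n
      at-vertex : ∀ v → ∃[ d ] (tail d ≡ v × d ∈ M × (∀ d' → tail d' ≡ v → d' ∈ M → d' ≡ d))
      at-vertex v with any? (λ d → (tail d ≟ v) ×-dec (d ∈? M))
      ... | no none = contradiction (trans (sym (degree-one v)) (Σᵥ-zero (ind M) λ d t → ind-∉ λ m → none (d , t , m))) λ ()
      ... | yes (d , t , m) = d , t , m , unique
        where
        unique : ∀ d' → tail d' ≡ v → d' ∈ M → d' ≡ d
        unique d' t' m' with d' ≟ d
        ... | yes e = e
        -- Two different darts of `M` at the vertex would already contribute 2 to a degree of 1.
        ... | no ne = contradiction (subst₂ ℤ._≤_ two (degree-one v) (sum-pair-≤ (atVertex v (ind M)) (nonneg v) ne))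
                        λ { (+≤+ (s≤s ())) }
          where
          two : atVertex v (ind M) d' + atVertex v (ind M) d ≡ + 2
          two = cong₂ _+_ (trans (atVertex-∈ (ind M) t') (ind-∈ m')) (trans (atVertex-∈ (ind M) t) (ind-∈ m))

    -- By uniqueness of potentials the prescribed levels are then the heights of `M`, so decoding
    -- reproduces the word.
    level-potential : Potential (flow M M0)
    level-potential = record
      { ht = height-of
      ; ht-φ = λ d → cong indicator (level-φ d)
      ; ht-∞ = cong indicator (level-∞ sf-refl)
      ; ht-α = λ d → trans (add-back (height-of (α d)) (height-of d)) (cong (_+_ (height-of d)) (sym (flow-M d)))
      }
      where
      add-back : ∀ y z → y ≡ z + (y + - z)
      add-back = solve-∀

    level-height : ∀ i → ht (height matching) (s i) ≡ indicator (x i)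
    level-height i = trans (potential-unique (λ _ → refl) (height matching) level-potential (s i))
                       (cong indicator (level-finite sf-refl))

  decode : ∀ y → InL G n s n y → Σ[ M ∈ Subset nD ] (PerfectMatching G M × PhiIs G n s M0 M y)
  decode y l = M , matching , λ i → phi-height matching (s i) (lookup y i) (level-height i)
    where open Decode (InL-respects l)

open PlaneBipartiteGraph using (nD)

theorem3p4 : (G : PlaneBipartiteGraph) → IsPlane G → Elementary G → ForcingInfiniteFace G →
    (n : ℕ) → 1 ≤ n → (s : Fin n → Fin (nD G)) → IsRFD G n s →
    (M0 : Subset (nD G)) → IsBottomMatching G M0 →
    ((M : Subset (nD G)) → PerfectMatching G M →
    Σ[ x ∈ Vec Bool n ] (InL G n s n x × PhiIs G n s M0 M x)) ×
    ((x : Vec Bool n) → InL G n s n x →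
    Σ[ M ∈ Subset (nD G) ] (PerfectMatching G M × PhiIs G n s M0 M x)) ×
    ((M M' : Subset (nD G)) → PerfectMatching G M → PerfectMatching G M' →
    (x : Vec Bool n) → PhiIs G n s M0 M x → PhiIs G n s M0 M' x → M ≡ M')
theorem3p4 G (connected , _) elementary forcing n 1≤n s rfd M0 bottom =
  (λ M P → tabulate (code P) , respects-InL wb? (code-respects P) 1≤n , code-phi P) ,
  decode ,
  λ M M' P P' x → phi-injective {x = x} P P'
  where
  open Language G n s
  open Coding G connected (elementary-no-leaf elementary 1≤n rfd) n s rfd M0 bottom (proj₂ elementary) forcing
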